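{- For any $n \geq 10$, $sat(K_4^n, C_5) = 4n+2$.
   Context: All graphs are finite, simple and undirected. $K_k^n$ denotes the complete $k$-partite graph with exactly $n$ vertices in each of its $k$ parts. $C_5$ is the cycle on $5$ vertices. For graphs $G$ and $F$, a spanning subgraph $H$ of $G$ is $F$-saturated relative to $G$ if $H$ contains no copy of $F$ but $H+e$ contains a copy of $F$ for every $e\in E(G)\setminus E(H)$; $sat(G,F)$ is the minimum number of edges of a graph that is $F$-saturated relative to $G$. -}

module Defs where

open import Data.Nat using (ℕ; zero; suc; _+_; _*_; ⌊_/2⌋)
open import Data.Fin using (Fin)
open import Data.Fin.Properties using () renaming (_≟_ to _≟F_)
open import Data.Bool using (Bool; true; false; _∨_; _∧_; if_then_else_)
open import Data.Product using (_×_; _,_; proj₁; proj₂; Σ; ∃; ∃-syntax)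
open import Data.Product.Properties using (≡-dec)
open import Data.List using (List; map; concatMap; allFin)
open import Data.Nat.ListAction using (sum)
open import Relation.Binary.PropositionalEquality using (_≡_; _≢_)
open import Relation.Nullary using (¬_)
open import Relation.Nullary.Decidable using (⌊_⌋)
open import Relation.Binary.Definitions using (DecidableEquality)

-- Vertices of K_4^n: a part index (Fin 4) together with a position in the part (Fin n).
Vertex : ℕ → Set
Vertex n = Fin 4 × Fin n

_≟V_ : ∀ {n} → DecidableEquality (Vertex n)
_≟V_ = ≡-dec _≟F_ _≟F_

KAdj : ∀ {n} → Vertex n → Vertex n → Set
KAdj u v = proj₁ u ≢ proj₁ v

Graph : ℕ → Set
Graph n = Vertex n → Vertex n → Bool

-- H is a (simple, undirected) spanning subgraph of K_4^n:
-- symmetric, and every edge of H is an edge of K_4^n (hence H is loopless).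
IsSpanningSubgraph : ∀ {n} → Graph n → Set
IsSpanningSubgraph {n} H =
  (∀ (u v : Vertex n) → H u v ≡ H v u) ×
  (∀ (u v : Vertex n) → H u v ≡ true → KAdj u v)

ContainsC5 : ∀ {n} → Graph n → Set
ContainsC5 {n} H =
  Σ (Vertex n) λ a → Σ (Vertex n) λ b → Σ (Vertex n) λ c →
  Σ (Vertex n) λ d → Σ (Vertex n) λ e →
    (a ≢ b × a ≢ c × a ≢ d × a ≢ e × b ≢ c × b ≢ d × b ≢ e ×
     c ≢ d × c ≢ e × d ≢ e) ×
    (H a b ≡ true × H b c ≡ true × H c d ≡ true × H d e ≡ true × H e a ≡ true)

addEdge : ∀ {n} → Graph n → Vertex n → Vertex n → Graph n
addEdge H u v x y =
  H x y ∨ (⌊ x ≟V u ⌋ ∧ ⌊ y ≟V v ⌋) ∨ (⌊ x ≟V v ⌋ ∧ ⌊ y ≟V u ⌋)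

IsC5SaturatedRelK4 : ∀ {n} → Graph n → Set
IsC5SaturatedRelK4 {n} H =
  IsSpanningSubgraph H ×
  ¬ ContainsC5 H ×
  (∀ (u v : Vertex n) → KAdj u v → H u v ≡ false → ContainsC5 (addEdge H u v))

vertices : (n : ℕ) → List (Vertex n)
vertices n = concatMap (λ i → map (λ j → (i , j)) (allFin n)) (allFin 4)

orderedEdgeCount : ∀ {n} → Graph n → ℕ
orderedEdgeCount {n} H =
  sum (map (λ u → sum (map (λ v → if H u v then 1 else 0) (vertices n))) (vertices n))

-- Number of edges of H (each undirected edge is counted twice above).
edgeCount : ∀ {n} → Graph n → ℕ
edgeCount H = ⌊ orderedEdgeCount H /2⌋

SatK4C5≡ : ℕ → ℕ → Set
SatK4C5≡ n m =
  (Σ (Graph n) λ H → IsC5SaturatedRelK4 H × edgeCount H ≡ m) ×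
  (∀ (H : Graph n) → IsC5SaturatedRelK4 H → m Data.Nat.≤ edgeCount H)

{-# OPTIONS --safe #-}
module Submission where

-- Lower bound: a saturated H is connected, with all depths of a breadth-first tree at most 5, so if
-- it had at most 4n + 1 edges, at most two of them would lie outside the tree. The ancestors of the
-- endpoints of these two edges contain at most nine vertices of each part, hence every part has an
-- outer vertex. From an outer vertex only its parent leads back, and saturation forces outer vertices
-- to be within distance two of an ancestor in the inner part, at distance two for at most one part. The
-- attachment points of four outer vertices, one in each part, must then be joined to each other and to
-- all other vertices by paths of prescribed lengths, and a finite search shows that this cannot be done
-- in a C₅-free graph in which k vertices span at most k + 1 edges.
--
-- Upper bound: K₄ with all other vertices attached as leaves, each part to a single vertex of K₄.

-- The obstacle is that saturation speaks about 4n vertices, while a search can handle only a few.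
-- Outer vertices remove it: no non-tree edge touches them, so a path of length four that starts at
-- an outer vertex can go up only along the tree. Once these forced steps are cut off, saturation
-- turns into the existence of shorter paths of fixed length from the attachment point, and n no
-- longer occurs. Sparsity is used only in a form inherited by every set of k vertices: at most k -
-- 1 tree edges and two others. The nine in the bound is 4 · 2 + 1: each of the four endpoints of
-- the extra edges heads a chain of ancestors, a chain has at most two vertices in a given part
-- besides the root, and the root is counted once. This is where the hypothesis n ≥ 10 comes from.

open import Defs
open import Data.Bool using (Bool; true; false; _∨_; _∧_; not; if_then_else_; T)
open import Data.Bool.ListAction using (any; all)
import Data.Bool.Properties as Bool
open import Data.Bool.Properties using (T-∧; T-∨; ∨-comm)
open import Data.Empty using (⊥; ⊥-elim)
open import Data.Fin as Fin using (Fin; zero; suc; toℕ; punchIn; combine)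
open import Data.Fin.Patterns
import Data.Fin.Properties as Fin
open import Data.List using (List; []; _∷_; _++_; map; length; upTo; cartesianProduct; allFin; lookup; tabulate)
open import Data.List.Membership.Propositional using (_∈_; _∉_; find)
open import Data.List.Membership.Propositional.Properties
  using (∈-map⁺; ∈-map⁻; ∈-upTo⁺; ∈-upTo⁻; ∈-cartesianProduct⁺; ∈-cartesianProduct⁻; ∈-∃++; ∈-++⁺ˡ; ∈-++⁺ʳ; ∈-++⁻; ∈-allFin)
open import Data.List.Properties
  using (map-cong; map-cong-local; map-++; map-∘; map-tabulate; length-++; length-map; length-tabulate; length-upTo)
open import Data.List.Relation.Binary.Subset.Propositional using (_⊆_)
open import Data.List.Relation.Unary.All as All using (All; []; _∷_)
import Data.List.Relation.Unary.All.Properties as All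
open import Data.List.Relation.Unary.AllPairs as AllPairs using (AllPairs; []; _∷_)
import Data.List.Relation.Unary.AllPairs.Properties as AllPairs
open import Data.List.Relation.Unary.Any as Any using (here; there)
open import Data.List.Relation.Unary.Any.Properties using (any⁻; any⁺)
open import Data.List.Relation.Unary.Unique.Propositional using (Unique)
import Data.List.Relation.Unary.Unique.Propositional.Properties as Unique
open import Data.Nat
  using (ℕ; zero; suc; pred; _+_; _*_; _∸_; _≤_; _<_; _≥_; _≡ᵇ_; _<ᵇ_; ⌊_/2⌋; z≤n; s≤s; z<s; s<s; s≤s⁻¹)
open import Data.Nat.ListAction using (sum)
open import Data.Nat.ListAction.Properties using (sum-++)
open import Data.Nat.Properties
open import Data.Nat.Solver using (module +-*-Solver)
open import Data.Product using (_×_; _,_; proj₁; proj₂; swap; ∃; ∃-syntax)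
open import Data.Sum using (_⊎_; inj₁; inj₂; [_,_]′)
open import Data.Unit using (tt)
open import Function using (_∘_; case_of_; id)
open import Function.Bundles using (Equivalence)
open import Relation.Binary.Definitions using (DecidableEquality)
open import Relation.Binary.PropositionalEquality
open import Relation.Nullary using (¬_; Dec; yes; no; contradiction; ⌊_⌋)
open import Relation.Nullary.Decidable using (map′; from-yes; decidable-stable; ¬?; _×-dec_; _⊎-dec_; _→-dec_)
open import Relation.Unary using (Decidable)

-- A search for contradictions in sparse C₅-saturated graphs

-- Partial knowledge of a coloured graph: it has the distinct vertices 0, …, size - 1, and among
-- them at least the listed edges and colours.
record State : Set where
  constructor state
  field
    size    : ℕ
    edges   : List (ℕ × ℕ)
    colours : List (ℕ × ℕ)
open State

_≐_ : ℕ × ℕ → ℕ × ℕ → Bool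
(a , b) ≐ (c , d) = (a ≡ᵇ c) ∧ (b ≡ᵇ d)

same : ℕ × ℕ → ℕ × ℕ → Bool
same (a , b) (c , d) = (a , b) ≐ (c , d) ∨ (a , b) ≐ (d , c)

member : ℕ → List ℕ → Bool
member x = any (x ≡ᵇ_)

adjacent : State → ℕ → ℕ → Bool
adjacent s a b = any (same (a , b)) (edges s)

hasPath : State → ℕ → ℕ → ℕ → List ℕ → Bool
hasPath s zero    a b vs = adjacent s a b
hasPath s (suc l) a b vs = any (λ (i , j) → ((i ≡ᵇ a) ∧ via j) ∨ ((j ≡ᵇ a) ∧ via i)) (edges s)
  where
  via : ℕ → Bool
  via x = not (x ≡ᵇ b) ∧ not (member x vs) ∧ hasPath s l x b (x ∷ vs)

addNew : State → State
addNew s = record s { size = suc (size s) }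

join : State → ℕ → ℕ → State
join s a b = record s { edges = (a , b) ∷ edges s }

paint : State → ℕ → ℕ → State
paint s v c = record s { colours = (v , c) ∷ colours s }

firstOf : {A : Set} → List A → (A → Bool) → (A → Bool) → Bool → Bool
firstOf []       applies branch otherwise = otherwise
firstOf (x ∷ xs) applies branch otherwise =
  if applies x then branch x else firstOf xs applies branch otherwise

-- The graphs contain no cycle of length len + 2, any k vertices span at most k + 1 edges, and
-- non-adjacent vertices of different colours are joined by a path with len interior vertices. A
-- pendant (c , l , is) stands for a path with l interior vertices from c to every other vertex whose
-- colour is not in is; (x , i) is forbidden when the vertex x does not have the colour i. The argument r
-- is a refutation procedure for the states in which the new edge or path is present.
module Search (len : ℕ) (pendants : List (ℕ × ℕ × List ℕ)) (forbidden : List (ℕ × ℕ)) where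

  withEdge : (State → Bool) → State → ℕ → ℕ → Bool
  withEdge r s a b =
    if adjacent s a b then r s
    -- The test looks at the edges before the new one is added: more than `size s` old edges
    -- together with the new one exceed the permitted `size s + 1`.
    else ((size s <ᵇ length (edges s)) ∨ hasPath s len a b (a ∷ []) ∨ r (join s a b))

  withPath : (State → Bool) → State → ℕ → ℕ → ℕ → List ℕ → Bool
  withPath r s zero    a b vs = withEdge r s a b
  withPath r s (suc l) a b vs =
    -- The next vertex of the path is either one already numbered or a new one, which receives the
    -- number `size s`; every alternative has to be refuted.
    all (λ x → (x ≡ᵇ b) ∨ member x vs ∨ withEdge (λ t → withPath r t l x b (x ∷ vs)) s a x) (upTo (size s))
    ∧ withEdge (λ t → withPath r t l (size s) b (size s ∷ vs)) (addNew s) a (size s)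

  excludes : State → ℕ → ℕ → Bool
  excludes s w i =
    any (λ (x , c) → ((x ≡ᵇ w) ∧ not (c ≡ᵇ i)) ∨ ((c ≡ᵇ i) ∧ adjacent s x w)) (colours s)
    ∨ any ((w , i) ≐_) forbidden

  clash : State → Bool
  clash s = any (λ (x , c) → excludes s x c) (colours s)

  differ : State → ℕ → ℕ → Bool
  differ s v w = any (λ (x , i) → (x ≡ᵇ v) ∧ excludes s w i) (colours s)

  coloured : State → ℕ → Bool
  coloured s v = any (λ (x , i) → x ≡ᵇ v) (colours s)

  pendantUnmet : State → ℕ × ℕ × ℕ × List ℕ → Bool
  pendantUnmet s (w , c , l , is) = not (w ≡ᵇ c) ∧ all (excludes s w) is ∧ not (hasPath s l c w (c ∷ []))

  linkUnmet : State → ℕ × ℕ → Bool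
  linkUnmet s (v , w) = differ s v w ∧ not (adjacent s v w) ∧ not (hasPath s len v w (v ∷ []))

  -- Each call commits to the first unmet requirement. All requirements hold in the actual graph, so
  -- their order affects only the cost and the success of the search, not its soundness. Exhausted
  -- fuel counts as failure to refute.
  refute : ℕ → State → Bool
  refute zero    s = false
  refute (suc f) s = clash s ∨
    firstOf (cartesianProduct (upTo (size s)) pendants) (pendantUnmet s)
      (λ (w , c , l , is) → withPath (refute f) s l c w (c ∷ []))
    (firstOf (cartesianProduct (upTo (size s)) (upTo (size s))) (linkUnmet s)
      (λ (v , w) → withEdge (refute f) s v w ∧ withPath (refute f) s len v w (v ∷ []))
    (firstOf (upTo (size s)) (λ v → not (coloured s v))
      (λ v → all (λ c → refute f (paint s v c)) (upTo 4))
    false))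

  refuteWith : List (ℕ × ℕ × ℕ) → ℕ → State → Bool
  refuteWith []                 f s = refute f s
  refuteWith ((a , b , l) ∷ ds) f s = if hasPath s l a b (a ∷ []) then refuteWith ds f s else withPath (refuteWith ds f) s l a b (a ∷ [])

-- Soundness of the search

split∧ : ∀ {x y} → T (x ∧ y) → T x × T y
split∧ = Equivalence.to T-∧

split∨ : ∀ {x y} → T (x ∨ y) → T x ⊎ T y
split∨ = Equivalence.to T-∨

T-not : ∀ {x} → T (not x) → ¬ T x
T-not {false} _ ()

≐⇒≡ : ∀ e f → T (e ≐ f) → e ≡ f
≐⇒≡ (a , b) (c , d) e≐f with split∧ {a ≡ᵇ c} e≐f
... | a≡c , b≡d with ≡ᵇ⇒≡ a c a≡c | ≡ᵇ⇒≡ b d b≡d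
... | refl | refl = refl

same⇒≡ : ∀ a b c d → T (same (a , b) (c , d)) → (a , b) ≡ (c , d) ⊎ (a , b) ≡ (d , c)
same⇒≡ a b c d t with split∨ {(a , b) ≐ (c , d)} t
... | inj₁ e = inj₁ (≐⇒≡ _ _ e)
... | inj₂ e = inj₂ (≐⇒≡ _ _ e)

T-member : ∀ {x xs} → x ∈ xs → T (member x xs)
T-member {x} x∈xs = any⁺ _ (Any.map (λ {y} x≡y → ≡⇒≡ᵇ x y x≡y) x∈xs)

member⇒∈ : ∀ {x} xs → T (member x xs) → x ∈ xs
member⇒∈ {x} xs t = Any.map (λ {y} → ≡ᵇ⇒≡ x y) (any⁻ (x ≡ᵇ_) xs t)

-- The number counts the interior vertices, and the list holds the vertices to be avoided.
module Paths {V : Set} (_~_ : V → V → Set) (Q : V → Set) where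

  SPath : ℕ → V → V → List V → Set
  SPath zero    u w vs = u ~ w
  SPath (suc l) u w vs = ∃[ z ] (u ~ z × Q z × z ≢ w × z ∉ vs × SPath l z w (z ∷ vs))

record Saturation (len : ℕ) {V : Set} (_~_ : V → V → Set) (Q : V → Set) (colour : V → ℕ) : Set where
  open Paths _~_ Q
  field
    decEq    : DecidableEquality V
    ~-sym    : ∀ {u v} → u ~ v → v ~ u
    proper   : ∀ {u v} → u ~ v → colour u ≢ colour v
    colour<4 : ∀ v → colour v < 4
    noCycle     : ∀ {u v} → u ~ v → ¬ SPath len u v (u ∷ [])
    linked   : ∀ {u v} → Q u → Q v → colour u ≢ colour v → u ~ v ⊎ SPath len u v (u ∷ [])
    sparse   : ∀ {k es} (φ : ℕ → V) → 0 < k → (∀ {i j} → i < k → j < k → φ i ≡ φ j → i ≡ j) →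
               All (λ (i , j) → i < k × j < k × φ i ~ φ j) es → AllPairs (λ e f → ¬ T (same e f)) es →
               length es ≤ suc k

module Soundness {V : Set} {_~_ : V → V → Set} {Q : V → Set} {colour : V → ℕ} {len : ℕ} (sat : Saturation len _~_ Q colour)
  (b : ℕ) (b>0 : 0 < b) (base : ℕ → V)
  (pendants : List (ℕ × ℕ × List ℕ)) (forbidden : List (ℕ × ℕ)) where

  open Saturation sat
  open Paths _~_ Q
  open Search len pendants forbidden

  -- `φ` embeds the partial knowledge `s` into the actual graph. The first `b` numbers are pinned to
  -- `base`, because pendants and forbidden colours refer to these vertices; later numbers are
  -- interpreted as the search introduces them.
  record _⊨_ (φ : ℕ → V) (s : State) : Set where
    field
      large    : b ≤ size s
      based    : ∀ {i} → i < b → φ i ≡ base i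
      distinct : ∀ {i j} → i < size s → j < size s → φ i ≡ φ j → i ≡ j
      good     : ∀ {i} → i < size s → Q (φ i)
      edges⊨   : All (λ (i , j) → i < size s × j < size s × φ i ~ φ j) (edges s)
      simple   : AllPairs (λ e f → ¬ T (same e f)) (edges s)
      colours⊨ : All (λ (i , c) → i < size s × colour (φ i) ≡ c) (colours s)
  open _⊨_

  same⇒~ : ∀ (φ : ℕ → V) a b c d → T (same (a , b) (c , d)) → φ c ~ φ d → φ a ~ φ b
  same⇒~ φ a b c d t c~d with same⇒≡ a b c d t
  ... | inj₁ refl = c~d
  ... | inj₂ refl = ~-sym c~d

  adjacent⇒~ : ∀ {φ s} → φ ⊨ s → ∀ a b → T (adjacent s a b) → φ a ~ φ b
  adjacent⇒~ {φ} {s} ⊨s a b t with find (any⁻ (same (a , b)) (edges s) t)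
  ... | (c , d) , cd∈ , t′ = same⇒~ φ a b c d t′ (proj₂ (proj₂ (All.lookup (edges⊨ ⊨s) cd∈)))

  ∉-map : ∀ {φ s} → φ ⊨ s → ∀ {x vs} → x < size s → All (_< size s) vs → ¬ T (member x vs) → φ x ∉ map φ vs
  ∉-map {φ} ⊨s x< vs< x∉ φx∈ with ∈-map⁻ φ φx∈
  ... | y , y∈ , φx≡φy with distinct ⊨s x< (All.lookup vs< y∈) φx≡φy
  ... | refl = x∉ (T-member y∈)

  hasPath⇒SPath : ∀ {φ s} → φ ⊨ s → ∀ l {a b vs} → b < size s → All (_< size s) vs →
                  T (hasPath s l a b vs) → SPath l (φ a) (φ b) (map φ vs)
  hasPath⇒SPath {φ} {s} ⊨s zero b< vs< t = adjacent⇒~ ⊨s _ _ t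
  hasPath⇒SPath {φ} {s} ⊨s (suc l) {a} {b} {vs} b< vs< t
    with find (any⁻ _ (edges s) t)
  ... | (i , j) , ij∈ , t′ with All.lookup (edges⊨ ⊨s) ij∈ | split∨ {(i ≡ᵇ a) ∧ _} t′
  ... | i< , j< , i~j | inj₁ p with split∧ {i ≡ᵇ a} p
  ... | i≡a , p′ rewrite ≡ᵇ⇒≡ i a i≡a with split∧ {not (j ≡ᵇ b)} p′
  ... | j≢b , p″ with split∧ {not (member j vs)} p″
  ... | j∉ , path = φ j , i~j , good ⊨s j< , (λ e → T-not j≢b (≡⇒≡ᵇ j b (distinct ⊨s j< b< e))) ,
                    ∉-map ⊨s j< vs< (T-not j∉) , hasPath⇒SPath ⊨s l b< (j< ∷ vs<) path
  hasPath⇒SPath {φ} {s} ⊨s (suc l) {a} {b} {vs} b< vs< t | (i , j) , ij∈ , t′ | i< , j< , i~j | inj₂ p with split∧ {j ≡ᵇ a} p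
  ... | j≡a , p′ rewrite ≡ᵇ⇒≡ j a j≡a with split∧ {not (i ≡ᵇ b)} p′
  ... | i≢b , p″ with split∧ {not (member i vs)} p″
  ... | i∉ , path = φ i , ~-sym i~j , good ⊨s i< , (λ e → T-not i≢b (≡⇒≡ᵇ i b (distinct ⊨s i< b< e))) ,
                    ∉-map ⊨s i< vs< (T-not i∉) , hasPath⇒SPath ⊨s l b< (i< ∷ vs<) path

  ¬adjacent⇒simple : ∀ a b es → ¬ T (any (same (a , b)) es) → All (λ f → ¬ T (same (a , b) f)) es
  ¬adjacent⇒simple a b es ¬adj = All.tabulate (λ f∈ t → ¬adj (any⁺ _ (Any.map (λ { refl → t }) f∈)))

  -- The continuation is required only for states that differ from `s` in their edges. Thus `φ` and
  -- `size s` stay fixed, and bounds on vertex numbers remain valid inside the continuation.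
  withEdge-sound : ∀ r {φ s} → φ ⊨ s → ∀ {a b} → a < size s → b < size s → φ a ~ φ b →
                   (∀ es → φ ⊨ record s { edges = es } → ¬ T (r (record s { edges = es }))) →
                   ¬ T (withEdge r s a b)
  withEdge-sound r {φ} {s} ⊨s {a} {b} a< b< a~b r-sound t with adjacent s a b in adj
  ... | true  = r-sound (edges s) ⊨s t
  ... | false with split∨ {size s <ᵇ length (edges s)} t
  ... | inj₁ many = 1+n≰n (≤-trans (s≤s (<ᵇ⇒< (size s) _ many)) (sparse {es = (a , b) ∷ edges s} φ (≤-trans b>0 (large ⊨s)) (distinct ⊨s)
                      ((a< , b< , a~b) ∷ edges⊨ ⊨s)
                      (¬adjacent⇒simple a b (edges s) (subst T adj) ∷ simple ⊨s)))
  ... | inj₂ t′ with split∨ {hasPath s len a b (a ∷ [])} t′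
  ... | inj₁ path = noCycle a~b (hasPath⇒SPath ⊨s len b< (a< ∷ []) path)
  ... | inj₂ t″ = r-sound ((a , b) ∷ edges s) record
        { large = large ⊨s ; based = based ⊨s ; distinct = distinct ⊨s ; good = good ⊨s
        ; edges⊨ = (a< , b< , a~b) ∷ edges⊨ ⊨s
        ; simple = ¬adjacent⇒simple a b (edges s) (subst T adj) ∷ simple ⊨s
        ; colours⊨ = colours⊨ ⊨s } t″

  _[_≔_] : (ℕ → V) → ℕ → V → ℕ → V
  (φ [ k ≔ z ]) i = if i ≡ᵇ k then z else φ i

  ≔-here : ∀ φ k z → (φ [ k ≔ z ]) k ≡ z
  ≔-here φ k z with k ≡ᵇ k in e
  ... | true  = refl
  ... | false = ⊥-elim (subst T e (≡⇒≡ᵇ k k refl))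

  ≔-below : ∀ φ {k} z {i} → i < k → (φ [ k ≔ z ]) i ≡ φ i
  ≔-below φ {k} z {i} i<k with i ≡ᵇ k in e
  ... | false = refl
  ... | true  = contradiction (≡ᵇ⇒≡ i k (subst T (sym e) tt)) (<⇒≢ i<k)

  addNew-⊨ : ∀ {φ s} → φ ⊨ s → ∀ {z} → Q z → (∀ {i} → i < size s → φ i ≢ z) → (φ [ size s ≔ z ]) ⊨ addNew s
  addNew-⊨ {φ} {s} ⊨s {z} Qz new = record
    { large = m≤n⇒m≤1+n (large ⊨s)
    ; based = λ i<b → trans (below (≤-trans i<b (large ⊨s))) (based ⊨s i<b)
    ; distinct = dist
    ; good = λ i< → case m<1+n⇒m<n∨m≡n i< of λ
        { (inj₁ i<k) → subst Q (sym (below i<k)) (good ⊨s i<k)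
        ; (inj₂ refl) → subst Q (sym here′) Qz }
    ; edges⊨ = All.map (λ (i< , j< , i~j) → m≤n⇒m≤1+n i< , m≤n⇒m≤1+n j< , subst₂ _~_ (sym (below i<)) (sym (below j<)) i~j) (edges⊨ ⊨s)
    ; simple = simple ⊨s
    ; colours⊨ = All.map (λ (i< , c) → m≤n⇒m≤1+n i< , trans (cong colour (below i<)) c) (colours⊨ ⊨s)
    }
    where
    φ′ = φ [ size s ≔ z ]
    below : ∀ {i} → i < size s → φ′ i ≡ φ i
    below = ≔-below φ z
    here′ : φ′ (size s) ≡ z
    here′ = ≔-here φ (size s) z
    dist : ∀ {i j} → i < suc (size s) → j < suc (size s) → φ′ i ≡ φ′ j → i ≡ j
    dist i< j< e with m<1+n⇒m<n∨m≡n i< | m<1+n⇒m<n∨m≡n j<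
    ... | inj₁ i<k  | inj₁ j<k  = distinct ⊨s i<k j<k (trans (sym (below i<k)) (trans e (below j<k)))
    ... | inj₁ i<k  | inj₂ refl = contradiction (trans (sym (below i<k)) (trans e here′)) (new i<k)
    ... | inj₂ refl | inj₁ j<k  = contradiction (trans (sym (below j<k)) (trans (sym e) here′)) (new j<k)
    ... | inj₂ refl | inj₂ refl = refl

  withPath-sound : ∀ r → (∀ {φ s} → φ ⊨ s → ¬ T (r s)) → ∀ l {φ s} → φ ⊨ s → ∀ {a b vs} → a < size s → b < size s →
                   All (_< size s) vs → SPath l (φ a) (φ b) (map φ vs) → ¬ T (withPath r s l a b vs)
  withPath-sound r r-sound zero ⊨s a< b< vs< a~b = withEdge-sound r ⊨s a< b< a~b (λ _ → r-sound)
  withPath-sound r r-sound (suc l) {φ} {s} ⊨s {a} {b} {vs} a< b< vs< (z , a~z , Qz , z≢b , z∉vs , path) t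
    with split∧ {all _ (upTo (size s))} t
  -- Whether the actual next vertex `z` is already numbered decides which conjunct of the search is
  -- contradicted; a fresh `z` extends `φ` at `size s`.
  ... | old , new with anyUpTo? (λ i → decEq (φ i) z) (size s)
  ... | yes (x , x< , refl) = case split∨ {x ≡ᵇ b} (All.lookup (All.all⁺ _ (upTo (size s)) old) (∈-upTo⁺ x<)) of λ
        { (inj₁ x≡b) → z≢b (cong φ (≡ᵇ⇒≡ x b x≡b))
        ; (inj₂ t′) → case split∨ {member x vs} t′ of λ
          { (inj₁ x∈) → z∉vs (∈-map⁺ φ (member⇒∈ vs x∈))
          ; (inj₂ t″) → withEdge-sound (λ t → withPath r t l x b (x ∷ vs)) ⊨s a< x< a~z
              (λ _ ⊨t → withPath-sound r r-sound l ⊨t x< b< (x< ∷ vs<) path) t″ } }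
  ... | no fresh = withEdge-sound (λ t → withPath r t l (size s) b (size s ∷ vs))
        (addNew-⊨ ⊨s Qz (λ i< e → fresh (_ , i< , e))) (m≤n⇒m≤1+n a<) (n<1+n _)
        (subst₂ _~_ (sym (≔-below φ z a<)) (sym (≔-here φ (size s) z)) a~z)
        (λ _ ⊨t → withPath-sound r r-sound l ⊨t (n<1+n _) (m≤n⇒m≤1+n b<) (n<1+n _ ∷ All.map m≤n⇒m≤1+n vs<) path′) new
    where
    φ′ = φ [ size s ≔ z ]
    path′ : SPath l (φ′ (size s)) (φ′ b) (φ′ (size s) ∷ map φ′ vs)
    path′ rewrite ≔-here φ (size s) z | ≔-below φ z b<
                | map-cong-local {f = φ′} {g = φ} (All.map (≔-below φ z) vs<) = path

  withLink-sound : ∀ r → (∀ {φ s} → φ ⊨ s → ¬ T (r s)) → ∀ l {φ s} → φ ⊨ s → ∀ {a b} → a < size s → b < size s →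
                   φ a ~ φ b ⊎ SPath l (φ a) (φ b) (φ a ∷ []) →
                   ¬ T (withEdge r s a b ∧ withPath r s l a b (a ∷ []))
  withLink-sound r r-sound l {φ} {s} ⊨s {a} {b} a< b< (inj₁ a~b) t =
    withEdge-sound r ⊨s a< b< a~b (λ _ → r-sound) (proj₁ (split∧ t))
  withLink-sound r r-sound l {φ} {s} ⊨s {a} {b} a< b< (inj₂ path) t =
    withPath-sound r r-sound l ⊨s a< b< (a< ∷ []) path (proj₂ (split∧ {withEdge r s a b} t))

  firstOf-sound : {A : Set} (xs : List A) {applies branch : A → Bool} {otherwise : Bool} →
                  (∀ {x} → x ∈ xs → T (applies x) → ¬ T (branch x)) → ¬ T otherwise →
                  ¬ T (firstOf xs applies branch otherwise)
  firstOf-sound []       _       otherwise-sound = otherwise-sound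
  firstOf-sound (x ∷ xs) {applies} x-sound otherwise-sound t with applies x in e
  ... | true  = x-sound (here refl) (subst T (sym e) tt) t
  ... | false = firstOf-sound xs (x-sound ∘ there) otherwise-sound t

  module _
    (pendant-path : ∀ {c l is} → (c , l , is) ∈ pendants →
      c < b × (∀ {w} → Q w → w ≢ base c → All (λ i → colour w ≢ i) is → SPath l (base c) w (base c ∷ [])))
    (forbidden-colour : ∀ {x i} → (x , i) ∈ forbidden → x < b × colour (base x) ≢ i) where

    excludes-sound : ∀ {φ s} → φ ⊨ s → ∀ w i → T (excludes s w i) → colour (φ w) ≢ i
    excludes-sound {φ} {s} ⊨s w i t with split∨ {any _ (colours s)} t
    ... | inj₂ f with find (any⁻ ((w , i) ≐_) forbidden f)
    ...   | (x , j) , xj∈ , t′ with ≐⇒≡ (w , i) (x , j) t′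
    ...     | refl with forbidden-colour xj∈
    ...       | w<b , ≢i = subst (λ v → colour v ≢ i) (sym (based ⊨s w<b)) ≢i
    excludes-sound {φ} {s} ⊨s w i t | inj₁ known with find (any⁻ _ (colours s) known)
    ... | (x , c) , xc∈ , t′ with All.lookup (colours⊨ ⊨s) xc∈ | split∨ {(x ≡ᵇ w) ∧ not (c ≡ᵇ i)} t′
    ... | x< , refl | inj₁ p with split∧ {x ≡ᵇ w} p
    ...   | x≡w , c≢i rewrite ≡ᵇ⇒≡ x w x≡w = λ e → T-not c≢i (≡⇒≡ᵇ _ i e)
    excludes-sound {φ} {s} ⊨s w i t | inj₁ known | (x , c) , xc∈ , t′ | x< , refl | inj₂ p with split∧ {colour (φ x) ≡ᵇ i} p
    ...   | c≡i , adj = λ e → proper (adjacent⇒~ ⊨s x w adj) (trans (≡ᵇ⇒≡ _ i c≡i) (sym e))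

    differ-sound : ∀ {φ s} → φ ⊨ s → ∀ v w → T (differ s v w) → colour (φ v) ≢ colour (φ w)
    differ-sound {φ} {s} ⊨s v w t with find (any⁻ _ (colours s) t)
    ... | (x , i) , xi∈ , t′ with split∧ {x ≡ᵇ v} t′ | All.lookup (colours⊨ ⊨s) xi∈
    ... | x≡v , ex | _ , refl rewrite ≡ᵇ⇒≡ x v x≡v = λ e → excludes-sound ⊨s w _ ex (sym e)

    clash-sound : ∀ {φ s} → φ ⊨ s → ¬ T (clash s)
    clash-sound {φ} {s} ⊨s t with find (any⁻ _ (colours s) t)
    ... | (x , c) , xc∈ , t′ = excludes-sound ⊨s x c t′ (proj₂ (All.lookup (colours⊨ ⊨s) xc∈))

    refute-sound : ∀ f {φ s} → φ ⊨ s → ¬ T (refute f s)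
    refute-sound (suc f) {φ} {s} ⊨s = [ clash-sound ⊨s , steps ]′ ∘ split∨ {clash s}
      where
      R = refute f

      IH : ∀ {φ s} → φ ⊨ s → ¬ T (R s)
      IH = refute-sound f

      byPendant : ∀ {x} → x ∈ cartesianProduct (upTo (size s)) pendants → T (pendantUnmet s x) →
                  let (w , c , l , is) = x in ¬ T (withPath R s l c w (c ∷ []))
      byPendant {w , c , l , is} x∈ t with ∈-cartesianProduct⁻ (upTo (size s)) pendants x∈ | split∧ {not (w ≡ᵇ c)} t
      ... | w∈ , p∈ | w≢c , t′ with split∧ {all (excludes s w) is} t′ | pendant-path p∈
      ...   | ex , _ | c<b , path = withPath-sound R IH l ⊨s c< w< (c< ∷ [])
              (subst (λ v → SPath l v (φ w) (v ∷ [])) (sym (based ⊨s c<b))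
                (path (good ⊨s w<) (λ e → T-not w≢c (≡⇒≡ᵇ w c (distinct ⊨s w< c< (trans e (sym (based ⊨s c<b))))))
                  (All.map (λ {i} → excludes-sound ⊨s w i) (All.all⁺ _ is ex))))
        where
        w< = ∈-upTo⁻ w∈
        c< = ≤-trans c<b (large ⊨s)

      byLink : ∀ {x} → x ∈ cartesianProduct (upTo (size s)) (upTo (size s)) → T (linkUnmet s x) →
               let (v , w) = x in ¬ T (withEdge R s v w ∧ withPath R s len v w (v ∷ []))
      byLink x∈ t with ∈-cartesianProduct⁻ (upTo (size s)) (upTo (size s)) x∈
      ... | v∈ , w∈ = withLink-sound R IH len ⊨s v< w<
              (linked (good ⊨s v<) (good ⊨s w<) (differ-sound ⊨s _ _ (proj₁ (split∧ t))))
        where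
        v< = ∈-upTo⁻ v∈
        w< = ∈-upTo⁻ w∈

      byColour : ∀ {v} → v ∈ upTo (size s) → T (not (coloured s v)) →
                 ¬ T (all (λ c → R (paint s v c)) (upTo 4))
      byColour {v} v∈ _ t = IH painted (All.lookup (All.all⁺ (λ c → R (paint s v c)) (upTo 4) t) (∈-upTo⁺ (colour<4 (φ v))))
        where
        painted : φ ⊨ paint s v (colour (φ v))
        painted = record
          { large = large ⊨s ; based = based ⊨s ; distinct = distinct ⊨s ; good = good ⊨s
          ; edges⊨ = edges⊨ ⊨s ; simple = simple ⊨s
          ; colours⊨ = (∈-upTo⁻ v∈ , refl) ∷ colours⊨ ⊨s }

      steps = firstOf-sound (cartesianProduct (upTo (size s)) pendants) byPendant
        (firstOf-sound (cartesianProduct (upTo (size s)) (upTo (size s))) byLink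
          (firstOf-sound (upTo (size s)) byColour (λ ())))

    refuteWith-sound : ∀ ds f {φ s} → All (λ (x , y , l) → x < b × y < b × SPath l (base x) (base y) (base x ∷ [])) ds →
                       φ ⊨ s → ¬ T (refuteWith ds f s)
    refuteWith-sound []                 f _ ⊨s = refute-sound f ⊨s
    refuteWith-sound ((x , y , l) ∷ ds) f {φ} {s} ((x< , y< , path) ∷ ps) ⊨s t with hasPath s l x y (x ∷ [])
    ... | true  = refuteWith-sound ds f ps ⊨s t
    ... | false = withPath-sound (refuteWith ds f) (refuteWith-sound ds f ps) l ⊨s x<s (≤-trans y< (large ⊨s)) (x<s ∷ []) path′ t
      where
      x<s = ≤-trans x< (large ⊨s)
      path′ : SPath l (φ x) (φ y) (φ x ∷ [])
      path′ rewrite based ⊨s x< | based ⊨s y< = path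

    -- The starting state has no edges: adjacencies and paths known beforehand enter through `ds`,
    -- so that they undergo the same case analysis as all other paths.
    unrefutable : ∀ ds f cs → All (λ (x , y , l) → x < b × y < b × SPath l (base x) (base y) (base x ∷ [])) ds →
                  All (λ (i , c) → i < b × colour (base i) ≡ c) cs →
                  (∀ {i j} → i < b → j < b → base i ≡ base j → i ≡ j) → (∀ {i} → i < b → Q (base i)) →
                  refuteWith ds f (state b [] cs) ≢ true
    unrefutable ds f cs paths colours distinct good refuted = refuteWith-sound ds f {base} paths
      (record { large = ≤-refl ; based = λ _ → refl ; distinct = distinct ; good = good ; edges⊨ = [] ; simple = [] ; colours⊨ = colours })
      (subst T (sym refuted) tt)

-- The vertices 0, …, 3 are the parents of outer vertices of the colours 0, …, 3.
shallowPendants : List (ℕ × ℕ × List ℕ)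
shallowPendants = (0 , 2 , 0 ∷ []) ∷ (1 , 2 , 1 ∷ []) ∷ (2 , 2 , 2 ∷ []) ∷ (3 , 2 , 3 ∷ []) ∷ []

shallowForbidden : List (ℕ × ℕ)
shallowForbidden = (0 , 0) ∷ (1 , 1) ∷ (2 , 2) ∷ (3 , 3) ∷ []

-- The path of length four between outer vertices of two parts enters and leaves through their
-- parents, which leaves one interior vertex between the parents.
shallowPaths : List (ℕ × ℕ × ℕ)
shallowPaths = (0 , 1 , 1) ∷ (0 , 2 , 1) ∷ (1 , 2 , 1) ∷ (0 , 3 , 1) ∷ (1 , 3 , 1) ∷ (2 , 3 , 1) ∷ []

-- The vertex 0 is the grandparent of an outer vertex of colour 3, whose parent is an outer vertex of
-- colour 0; the vertices 1 and 2 are the parents of outer vertices of the colours 1 and 2; the vertex 3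
-- is one more vertex of colour 0.
deepPendants : List (ℕ × ℕ × List ℕ)
deepPendants = (0 , 2 , 0 ∷ []) ∷ (1 , 2 , 1 ∷ []) ∷ (2 , 2 , 2 ∷ []) ∷ (0 , 1 , 0 ∷ 3 ∷ []) ∷ []

deepForbidden : List (ℕ × ℕ)
deepForbidden = (1 , 1) ∷ (2 , 2) ∷ []

-- A path of length four from the deep outer vertex spends two steps on reaching vertex 0, so one
-- interior vertex remains. If it ends in another outer vertex, that interior vertex is the parent
-- of the end, whence the adjacencies of 0 with 1 and 2.
deepPaths : List (ℕ × ℕ × ℕ)
deepPaths = (0 , 1 , 0) ∷ (0 , 2 , 0) ∷ (1 , 2 , 1) ∷ (0 , 3 , 1) ∷ []

deepColours : List (ℕ × ℕ)
deepColours = (0 , 3) ∷ (3 , 0) ∷ []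

-- Both searches are run by the type checker. The fuel 20 has no other meaning than being large
-- enough; too small a value would yield `false`.
refuted-shallow : Search.refuteWith 3 shallowPendants shallowForbidden shallowPaths 20 (state 4 [] []) ≡ true
refuted-shallow = refl

refuted-deep : Search.refuteWith 3 deepPendants deepForbidden deepPaths 20 (state 4 [] deepColours) ≡ true
refuted-deep = refl

rank : Fin 4 → Fin 4 → Fin 4 → Fin 4 → Fin 4
rank a b c i = if ⌊ i Fin.≟ a ⌋ then 0F else if ⌊ i Fin.≟ b ⌋ then 1F else if ⌊ i Fin.≟ c ⌋ then 2F else 3F

abstract
  rank-complete : ∀ d a → d ≡ a ⊎ ∃[ b ] ∃[ c ] ((∀ i j → rank a b c i ≡ rank a b c j → i ≡ j) ×
                  rank a b c a ≡ 0F × rank a b c b ≡ 1F × rank a b c c ≡ 2F × rank a b c d ≡ 3F)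
  rank-complete = from-yes (Fin.all? λ d → Fin.all? λ a → (d Fin.≟ a) ⊎-dec Fin.any? λ b → Fin.any? λ c →
    (Fin.all? λ i → Fin.all? λ j → (rank a b c i Fin.≟ rank a b c j) →-dec (i Fin.≟ j)) ×-dec
    (rank a b c a Fin.≟ 0F) ×-dec (rank a b c b Fin.≟ 1F) ×-dec (rank a b c c Fin.≟ 2F) ×-dec (rank a b c d Fin.≟ 3F))

-- The deep outer vertex may lie in any part `d` and its parent in any other part `a`. Renaming the
-- parts lets a single search, with the colours 3 and 0, cover all these cases.
ranking : ∀ {d a} → d ≢ a → ∃[ f ] ((∀ {i j : Fin 4} → f i ≡ f j → i ≡ j) ×
          f a ≡ 0F × (∃[ b ] f b ≡ 1F) × (∃[ c ] f c ≡ 2F) × f d ≡ 3F)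
ranking {d} {a} d≢a with rank-complete d a
... | inj₁ d≡a = contradiction d≡a d≢a
... | inj₂ (b , c , injective , fa , fb , fc , fd) = rank a b c , injective _ _ , fa , (b , fb) , (c , fc) , fd


module _ {A : Set} where

  four : A → A → A → A → ℕ → A
  four a b c d 0 = a
  four a b c d 1 = b
  four a b c d 2 = c
  four a b c d _ = d

  four-injective : ∀ {a b c d} → a ≢ b → a ≢ c → a ≢ d → b ≢ c → b ≢ d → c ≢ d →
                   ∀ {i j} → i < 4 → j < 4 → four a b c d i ≡ four a b c d j → i ≡ j
  four-injective ab ac ad bc bd cd {0} {0} _ _ e = refl
  four-injective ab ac ad bc bd cd {0} {1} _ _ e = contradiction e ab
  four-injective ab ac ad bc bd cd {0} {2} _ _ e = contradiction e ac
  four-injective ab ac ad bc bd cd {0} {3} _ _ e = contradiction e ad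
  four-injective ab ac ad bc bd cd {1} {0} _ _ e = contradiction (sym e) ab
  four-injective ab ac ad bc bd cd {1} {1} _ _ e = refl
  four-injective ab ac ad bc bd cd {1} {2} _ _ e = contradiction e bc
  four-injective ab ac ad bc bd cd {1} {3} _ _ e = contradiction e bd
  four-injective ab ac ad bc bd cd {2} {0} _ _ e = contradiction (sym e) ac
  four-injective ab ac ad bc bd cd {2} {1} _ _ e = contradiction (sym e) bc
  four-injective ab ac ad bc bd cd {2} {2} _ _ e = refl
  four-injective ab ac ad bc bd cd {2} {3} _ _ e = contradiction e cd
  four-injective ab ac ad bc bd cd {3} {0} _ _ e = contradiction (sym e) ad
  four-injective ab ac ad bc bd cd {3} {1} _ _ e = contradiction (sym e) bd
  four-injective ab ac ad bc bd cd {3} {2} _ _ e = contradiction (sym e) cd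
  four-injective ab ac ad bc bd cd {3} {3} _ _ e = refl
  four-injective _ _ _ _ _ _ {suc (suc (suc (suc _)))} (s≤s (s≤s (s≤s (s≤s ())))) _ _
  four-injective _ _ _ _ _ _ {_} {suc (suc (suc (suc _)))} _ (s≤s (s≤s (s≤s (s≤s ())))) _

  four-all : {P : A → Set} → ∀ {a b c d} → P a → P b → P c → P d → ∀ i → P (four a b c d i)
  four-all pa pb pc pd 0 = pa
  four-all pa pb pc pd 1 = pb
  four-all pa pb pc pd 2 = pc
  four-all pa pb pc pd (suc (suc (suc _))) = pd

0<4 : 0 < 4
0<4 = z<s
1<4 : 1 < 4
1<4 = s<s z<s
2<4 : 2 < 4
2<4 = s<s (s<s z<s)
3<4 : 3 < 4
3<4 = s<s (s<s (s<s z<s))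

-- Counting edges

sum-map-++ : {A : Set} (g : A → ℕ) (xs ys : List A) → sum (map g (xs ++ ys)) ≡ sum (map g xs) + sum (map g ys)
sum-map-++ g xs ys = trans (cong sum (map-++ g xs ys)) (sum-++ (map g xs) (map g ys))

-- A weighted pigeonhole principle: the constant weight 1 compares lengths of lists, and the
-- adjacency indicator bounds the number of edges from below.
length≤sum : {A : Set} (g : A → ℕ) {L K : List A} → Unique L → L ⊆ K → All (λ x → 1 ≤ g x) L → length L ≤ sum (map g K)
length≤sum g [] L⊆K [] = z≤n
length≤sum g {x ∷ L} (x∉ ∷ unique) L⊆K (1≤gx ∷ 1≤g) with ∈-∃++ (L⊆K (here refl))
... | ys , zs , refl = begin
  suc (length L)                                       ≤⟨ +-mono-≤ 1≤gx (length≤sum g unique L⊆rest 1≤g) ⟩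
  g x + sum (map g (ys ++ zs))                         ≡⟨ cong (g x +_) (sum-map-++ g ys zs) ⟩
  g x + (sum (map g ys) + sum (map g zs))              ≡⟨ +-assoc (g x) _ _ ⟨
  g x + sum (map g ys) + sum (map g zs)                ≡⟨ cong (_+ sum (map g zs)) (+-comm (g x) _) ⟩
  sum (map g ys) + g x + sum (map g zs)                ≡⟨ +-assoc (sum (map g ys)) _ _ ⟩
  sum (map g ys) + (g x + sum (map g zs))              ≡⟨ sum-map-++ g ys (x ∷ zs) ⟨
  sum (map g (ys ++ x ∷ zs))                           ∎
  where
  open ≤-Reasoning
  L⊆rest : L ⊆ ys ++ zs
  L⊆rest y∈ with ∈-++⁻ ys (L⊆K (there y∈))
  ... | inj₁ y∈ys           = ∈-++⁺ˡ y∈ys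
  ... | inj₂ (here refl)    = contradiction refl (All.lookup x∉ y∈)
  ... | inj₂ (there y∈zs)   = ∈-++⁺ʳ ys y∈zs

sum-const : {A : Set} (c : ℕ) (xs : List A) → sum (map (λ _ → c) xs) ≡ length xs * c
sum-const c []       = refl
sum-const c (x ∷ xs) = cong (c +_) (sum-const c xs)

sum-cartesianProduct : {A B : Set} (g : A × B → ℕ) (xs : List A) (ys : List B) →
                       sum (map g (cartesianProduct xs ys)) ≡ sum (map (λ x → sum (map (λ y → g (x , y)) ys)) xs)
sum-cartesianProduct g []       ys = refl
sum-cartesianProduct g (x ∷ xs) ys = trans (sum-map-++ g (map (x ,_) ys) _)
  (cong₂ _+_ (cong sum (sym (map-∘ ys))) (sum-cartesianProduct g xs ys))

-- `vertices n` and the cartesian product evaluate to the same list, since `allFin 4` is closed;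
-- this is why library facts on products apply directly.
∈-vertices : ∀ {n} (v : Vertex n) → v ∈ vertices n
∈-vertices (i , j) = ∈-cartesianProduct⁺ (∈-allFin i) (∈-allFin j)

vertices-unique : ∀ n → Unique (vertices n)
vertices-unique n = Unique.cartesianProduct⁺ (Unique.allFin⁺ 4) (Unique.allFin⁺ n)

sum-ones : {A : Set} (xs : List A) → sum (map (λ _ → 1) xs) ≡ length xs
sum-ones xs = trans (sum-const 1 xs) (*-identityʳ (length xs))

length-vertices : ∀ n → length (vertices n) ≡ 4 * n
length-vertices n = begin
  length (vertices n)                                                ≡⟨ sum-ones (vertices n) ⟨
  sum (map (λ _ → 1) (vertices n))                                   ≡⟨ sum-cartesianProduct {B = Fin n} (λ _ → 1) (allFin 4) (allFin n) ⟩
  4 * sum (map (λ _ → 1) (allFin n))                                 ≡⟨ cong (4 *_) (trans (sum-ones (allFin n)) (length-tabulate {n = n} _)) ⟩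
  4 * n                                                              ∎
  where open ≡-Reasoning

_≄_ : {A : Set} → A × A → A × A → Set
e ≄ f = e ≢ f × e ≢ swap f

module _ {n : ℕ} (H : Graph n) (H-sym : ∀ u v → H u v ≡ H v u) (H-proper : ∀ u v → H u v ≡ true → KAdj u v) where

  -- `edgeCount` halves a count of ordered pairs, so the reversed edges are appended before
  -- comparing. The two copies are disjoint: distinct edges differ also up to reversal, and no edge
  -- is its own reversal because its ends lie in different parts.
  length≤edgeCount : ∀ {es} → AllPairs _≄_ es → All (λ (u , v) → H u v ≡ true) es → length es ≤ edgeCount H
  length≤edgeCount {es} distinct edges = begin
    length es                                   ≡⟨ n≡⌊n+n/2⌋ (length es) ⟩
    ⌊ length es + length es /2⌋                 ≡⟨ cong (λ k → ⌊ length es + k /2⌋) (length-map swap es) ⟨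
    ⌊ length es + length (map swap es) /2⌋      ≡⟨ cong ⌊_/2⌋ (length-++ es) ⟨
    ⌊ length (es ++ map swap es) /2⌋            ≤⟨ ⌊n/2⌋-mono (length≤sum weight unique
                                                     (λ {(u , v)} _ → ∈-cartesianProduct⁺ (∈-vertices u) (∈-vertices v)) heavy) ⟩
    ⌊ sum (map weight (cartesianProduct (vertices n) (vertices n))) /2⌋
                                                ≡⟨ cong ⌊_/2⌋ (sum-cartesianProduct weight (vertices n) (vertices n)) ⟩
    edgeCount H                                 ∎
    where
    open ≤-Reasoning
    weight : Vertex n × Vertex n → ℕ
    weight (u , v) = if H u v then 1 else 0

    1≤weight : ∀ {u v} → H u v ≡ true → 1 ≤ weight (u , v)
    1≤weight Huv rewrite Huv = ≤-refl

    heavy : All (λ e → 1 ≤ weight e) (es ++ map swap es)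
    heavy = All.++⁺ (All.map 1≤weight edges) (All.map⁺ (All.map (λ {(u , v)} Huv → 1≤weight (trans (H-sym v u) Huv)) edges))

    crossed : ∀ {es} → AllPairs _≄_ es → All (λ (u , v) → H u v ≡ true) es → ∀ {e f} → e ∈ es → f ∈ es → e ≢ swap f
    crossed (_ ∷ _) (Huv ∷ _) (here refl) (here refl) e = H-proper _ _ Huv (cong proj₁ (cong proj₁ e))
    crossed (d ∷ _) (_ ∷ _) (here refl) (there f∈) e = proj₂ (All.lookup d f∈) e
    crossed (d ∷ _) (_ ∷ _) (there e∈) (here refl) e = proj₂ (All.lookup d e∈) (cong swap (sym e))
    crossed (_ ∷ ds) (_ ∷ edges) (there e∈) (there f∈) e = crossed ds edges e∈ f∈ e

    unique : Unique (es ++ map swap es)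
    unique = Unique.++⁺ (AllPairs.map proj₁ distinct) (Unique.map⁺ (λ { refl → refl }) (AllPairs.map proj₁ distinct))
      λ (e∈ , f∈) → let (g , g∈ , e≡) = ∈-map⁻ swap f∈ in crossed distinct edges e∈ g∈ e≡

unique-below : ∀ {xs m} → Unique xs → All (_< m) xs → length xs ≤ m
unique-below {xs} {m} unique below = begin
  length xs                         ≤⟨ length≤sum (λ _ → 1) unique (λ x∈ → ∈-upTo⁺ (All.lookup below x∈)) (All.universal (λ _ → ≤-refl) xs) ⟩
  _                                 ≡⟨ sum-ones (upTo m) ⟩
  length (upTo m)                   ≡⟨ length-upTo m ⟩
  m                                 ∎
  where open ≤-Reasoning

minimum-at : (f : ℕ → ℕ) → ∀ {k} → 0 < k → ∃[ μ ] (μ < k × (∀ {i} → i < k → f μ ≤ f i))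
minimum-at f {suc zero} _ = 0 , z<s , λ { z<s → ≤-refl }
minimum-at f {suc (suc k)} _ with minimum-at f {suc k} z<s
... | μ , μ< , min with ≤-total (f μ) (f (suc k))
... | inj₁ μ≤ = μ , m≤n⇒m≤1+n μ< , λ i< → case m<1+n⇒m<n∨m≡n i< of λ { (inj₁ i<k) → min i<k ; (inj₂ refl) → μ≤ }
... | inj₂ ≤μ = suc k , ≤-refl , λ i< → case m<1+n⇒m<n∨m≡n i< of λ { (inj₁ i<k) → ≤-trans ≤μ (min i<k) ; (inj₂ refl) → ≤-refl }

-- C₅-saturated graphs and their breadth-first trees

anyVertex? : ∀ {n} {P : Vertex n → Set} → Decidable P → Dec (∃ P)
anyVertex? P? = map′ (λ (i , j , p) → (i , j) , p) (λ ((i , j) , p) → i , j , p) (Fin.any? λ i → Fin.any? λ j → P? (i , j))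

least : {P : ℕ → Set} → Decidable P → ∀ {m} → P m → ∃[ k ] (P k × (∀ {j} → P j → k ≤ j))
least P? {zero} p = zero , p , λ _ → z≤n
least {P} P? {suc m} p with P? zero
... | yes p₀ = zero , p₀ , λ _ → z≤n
... | no ¬p₀ with least (P? ∘ suc) p
... | k , pk , below = suc k , pk , λ { {zero} p₀ → contradiction p₀ ¬p₀ ; {suc j} pj → s≤s (below pj) }

module Saturated {n : ℕ} (H : Graph n) (saturated : IsC5SaturatedRelK4 H) where

  infix 4 _~_
  _~_ : Vertex n → Vertex n → Set
  u ~ v = H u v ≡ true

  _~?_ : ∀ u v → Dec (u ~ v)
  u ~? v = H u v Bool.≟ true

  H-sym : ∀ u v → H u v ≡ H v u
  H-sym = proj₁ (proj₁ saturated)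

  ~-sym : ∀ {u v} → u ~ v → v ~ u
  ~-sym {u} {v} = trans (H-sym v u)

  proper : ∀ {u v} → u ~ v → KAdj u v
  proper = proj₂ (proj₁ saturated) _ _

  ~⇒≢ : ∀ {u v} → u ~ v → u ≢ v
  ~⇒≢ u~v refl = proper u~v refl

  -- Only inequalities that do not follow from an edge of the path are stored. That of the two ends
  -- comes from the context, where the ends lie in different parts.
  record Path₄ (u w : Vertex n) : Set where
    constructor path₄
    field
      {a b c} : Vertex n
      u~a : u ~ a
      a~b : a ~ b
      b~c : b ~ c
      c~w : c ~ w
      u≢b : u ≢ b
      u≢c : u ≢ c
      a≢c : a ≢ c
      a≢w : a ≢ w
      b≢w : b ≢ w

  reverse₄ : ∀ {u w} → Path₄ u w → Path₄ w u
  reverse₄ (path₄ u~a a~b b~c c~w u≢b u≢c a≢c a≢w b≢w) =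
    path₄ (~-sym c~w) (~-sym b~c) (~-sym a~b) (~-sym u~a) (b≢w ∘ sym) (a≢w ∘ sym) (a≢c ∘ sym) (u≢c ∘ sym) (u≢b ∘ sym)

  no-chord : ∀ {u w} → u ~ w → ¬ Path₄ u w
  no-chord {u} {w} u~w (path₄ {a} {b} {c} u~a a~b b~c c~w u≢b u≢c a≢c a≢w b≢w) =
    proj₁ (proj₂ saturated) (u , a , b , c , w ,
      (~⇒≢ u~a , u≢b , u≢c , ~⇒≢ u~w , ~⇒≢ a~b , a≢c , a≢w , ~⇒≢ b~c , b≢w , ~⇒≢ c~w) ,
      (u~a , a~b , b~c , c~w , ~-sym u~w))

  private
    Is : (u v x y : Vertex n) → Set
    Is u v x y = (x ≡ u × y ≡ v) ⊎ (x ≡ v × y ≡ u)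

    new? : ∀ {u v x y} → addEdge H u v x y ≡ true → x ~ y ⊎ Is u v x y
    new? {u} {v} {x} {y} e with H x y | x ≟V u | y ≟V v | x ≟V v | y ≟V u
    ... | true  | _     | _     | _     | _     = inj₁ refl
    ... | false | yes p | yes q | _     | _     = inj₂ (inj₁ (p , q))
    ... | false | yes _ | no _  | yes p | yes q = inj₂ (inj₂ (p , q))
    ... | false | no _  | _     | yes p | yes q = inj₂ (inj₂ (p , q))
    new? () | false | yes _ | no _ | no _ | _
    new? () | false | yes _ | no _ | yes _ | no _
    new? () | false | no _ | _ | no _ | _
    new? () | false | no _ | _ | yes _ | no _

    old : ∀ {u v x y z} → addEdge H u v x y ≡ true → x ≢ z → y ≢ z → z ≡ u ⊎ z ≡ v → x ~ y
    old e x≢z y≢z z≡ with new? e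
    old e x≢z y≢z z≡ | inj₁ x~y = x~y
    old e x≢z y≢z (inj₁ refl) | inj₂ (inj₁ (x≡ , _)) = contradiction x≡ x≢z
    old e x≢z y≢z (inj₁ refl) | inj₂ (inj₂ (_ , y≡)) = contradiction y≡ y≢z
    old e x≢z y≢z (inj₂ refl) | inj₂ (inj₁ (_ , y≡)) = contradiction y≡ y≢z
    old e x≢z y≢z (inj₂ refl) | inj₂ (inj₂ (x≡ , _)) = contradiction x≡ x≢z

    record Pentagon (G : Graph n) (a b c d e : Vertex n) : Set where
      field
        ab : G a b ≡ true
        bc : G b c ≡ true
        cd : G c d ≡ true
        de : G d e ≡ true
        ea : G e a ≡ true
        a≢b : a ≢ b
        a≢c : a ≢ c
        a≢d : a ≢ d
        a≢e : a ≢ e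
        b≢c : b ≢ c
        b≢d : b ≢ d
        b≢e : b ≢ e
        c≢d : c ≢ d
        c≢e : c ≢ e
        d≢e : d ≢ e

    rotate : ∀ {G a b c d e} → Pentagon G a b c d e → Pentagon G b c d e a
    rotate P = record
      { ab = bc ; bc = cd ; cd = de ; de = ea ; ea = ab
      ; a≢b = b≢c ; a≢c = b≢d ; a≢d = b≢e ; a≢e = a≢b ∘ sym ; b≢c = c≢d ; b≢d = c≢e ; b≢e = a≢c ∘ sym
      ; c≢d = d≢e ; c≢e = a≢d ∘ sym ; d≢e = a≢e ∘ sym }
      where open Pentagon P

    -- Both `a` and `b` are ends of the added edge, and each of the other four sides misses one of
    -- them; hence these sides are edges of `H`.
    cut : ∀ {u v a b c d e} → Pentagon (addEdge H u v) a b c d e → Is u v a b → Path₄ u v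
    cut {u} {v} {a} {b} P is = case is of λ
      { (inj₁ (refl , refl)) → reverse₄ (go (inj₁ refl) (inj₂ refl))
      ; (inj₂ (refl , refl)) → go (inj₂ refl) (inj₁ refl) }
      where
      open Pentagon P
      go : a ≡ u ⊎ a ≡ v → b ≡ u ⊎ b ≡ v → Path₄ b a
      go a∈ b∈ = path₄ (old bc (a≢b ∘ sym) (a≢c ∘ sym) a∈) (old cd (a≢c ∘ sym) (a≢d ∘ sym) a∈) (old de (a≢d ∘ sym) (a≢e ∘ sym) a∈)
                 (old ea (b≢e ∘ sym) a≢b b∈) b≢d b≢e c≢e (a≢c ∘ sym) (a≢d ∘ sym)

  -- Since `H` has no pentagon, one of the five sides is the added edge; rotation makes it the first
  -- side. Saturation is used below only through this consequence.
  linked : ∀ {u v} → KAdj u v → u ~ v ⊎ Path₄ u v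
  linked {u} {v} uv with H u v in Huv
  ... | true  = inj₁ refl
  ... | false with proj₂ (proj₂ saturated) u v uv Huv
  ... | a , b , c , d , e , (a≢b , a≢c , a≢d , a≢e , b≢c , b≢d , b≢e , c≢d , c≢e , d≢e) , (ab , bc , cd , de , ea) = inj₂ path
    where
    P₁ : Pentagon (addEdge H u v) a b c d e
    P₁ = record
      { ab = ab ; bc = bc ; cd = cd ; de = de ; ea = ea ; a≢b = a≢b ; a≢c = a≢c ; a≢d = a≢d ; a≢e = a≢e
      ; b≢c = b≢c ; b≢d = b≢d ; b≢e = b≢e ; c≢d = c≢d ; c≢e = c≢e ; d≢e = d≢e }
    P₂ = rotate P₁
    P₃ = rotate P₂
    P₄ = rotate P₃
    P₅ = rotate P₄
    path : Path₄ u v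
    path with new? ab | new? bc | new? cd | new? de | new? ea
    ... | inj₂ is | _ | _ | _ | _ = cut P₁ is
    ... | inj₁ _ | inj₂ is | _ | _ | _ = cut P₂ is
    ... | inj₁ _ | inj₁ _ | inj₂ is | _ | _ = cut P₃ is
    ... | inj₁ _ | inj₁ _ | inj₁ _ | inj₂ is | _ = cut P₄ is
    ... | inj₁ _ | inj₁ _ | inj₁ _ | inj₁ _ | inj₂ is = cut P₅ is
    ... | inj₁ ab′ | inj₁ bc′ | inj₁ cd′ | inj₁ de′ | inj₁ ea′ =
      ⊥-elim (proj₁ (proj₂ saturated) (a , b , c , d , e , (a≢b , a≢c , a≢d , a≢e , b≢c , b≢d , b≢e , c≢d , c≢e , d≢e) , (ab′ , bc′ , cd′ , de′ , ea′)))

  -- The convention that the root is its own parent lets ancestor chains run on past the root, so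
  -- that iterating `parent` a fixed number of times needs no case distinction.
  record SpanningTree (r : Vertex n) : Set where
    field
      depth        : Vertex n → ℕ
      parent       : Vertex n → Vertex n
      depth≤5      : ∀ v → depth v ≤ 5
      depth≤4      : ∀ {v} → KAdj r v → depth v ≤ 4
      depth-root   : depth r ≡ 0
      parent-root  : parent r ≡ r
      ~-parent     : ∀ {v} → v ≢ r → v ~ parent v
      depth-parent : ∀ {v} → v ≢ r → depth v ≡ suc (depth (parent v))

  module Levels (r : Vertex n) where

    Reach : ℕ → Vertex n → Set
    Reach zero    v = r ≡ v
    Reach (suc k) v = ∃[ u ] (Reach k u × u ~ v)

    reach? : ∀ k → Decidable (Reach k)
    reach? zero    v = r ≟V v
    reach? (suc k) v = anyVertex? λ u → reach? k u ×-dec (u ~? v)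

    reach-other : ∀ {v} → KAdj r v → ∃[ k ] (Reach k v × k ≤ 4)
    reach-other rv with linked rv
    ... | inj₁ r~v = 1 , (r , refl , r~v) , s≤s z≤n
    ... | inj₂ (path₄ r~a a~b b~c c~v _ _ _ _ _) = 4 , (_ , (_ , (_ , (r , refl , r~a) , a~b) , b~c) , c~v) , ≤-refl

    neighbour : ∀ {v} (i : Fin 4) → proj₁ v ≢ i → ∃[ u ] (u ~ v)
    neighbour {v} i v≢i with linked {u = i , proj₂ r} {v = v} (v≢i ∘ sym)
    ... | inj₁ u~v = _ , u~v
    ... | inj₂ (path₄ _ _ _ c~v _ _ _ _ _) = _ , c~v

    -- A vertex in the root's part has some neighbour. This neighbour lies in another part, within
    -- distance four of the root, which accounts for the fifth step.
    reach-any : ∀ v → ∃[ k ] (Reach k v × k ≤ 5)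
    reach-any v with proj₁ r Fin.≟ proj₁ v
    ... | no rv = let (k , p , k≤) = reach-other rv in k , p , m≤n⇒m≤1+n k≤
    ... | yes rv with neighbour (punchIn (proj₁ v) zero) (λ e → Fin.punchInᵢ≢i (proj₁ v) zero (sym e))
    ... | u , u~v with reach-other {u} (λ e → proper u~v (trans (sym e) rv))
    ... | k , p , k≤ = suc k , (u , p , u~v) , s≤s k≤

    level : ∀ v → ∃[ k ] (Reach k v × (∀ {j} → Reach j v → k ≤ j))
    level v = least (λ k → reach? k v) (proj₁ (proj₂ (reach-any v)))

    depth : Vertex n → ℕ
    depth v = proj₁ (level v)

    depth-minimal : ∀ {v j} → Reach j v → depth v ≤ j
    depth-minimal {v} = proj₂ (proj₂ (level v))

    depth≤5 : ∀ v → depth v ≤ 5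
    depth≤5 v = let (k , p , k≤) = reach-any v in ≤-trans (depth-minimal p) k≤

    depth≤4 : ∀ {v} → KAdj r v → depth v ≤ 4
    depth≤4 rv = let (k , p , k≤) = reach-other rv in ≤-trans (depth-minimal p) k≤

    depth-root : depth r ≡ 0
    depth-root = n≤0⇒n≡0 (depth-minimal refl)

    up : ∀ v → ∃[ u ] ((v ≡ r × u ≡ r) ⊎ (v ≢ r × v ~ u × depth v ≡ suc (depth u)))
    up v with proj₁ (level v) | proj₁ (proj₂ (level v)) | proj₂ (proj₂ (level v)) | v ≟V r
    ... | _     | _             | _   | yes v≡r = r , inj₁ (v≡r , refl)
    ... | zero  | r≡v           | _   | no v≢r  = contradiction (sym r≡v) v≢r
    ... | suc k | u , p , u~v   | min | no v≢r  =
      u , inj₂ (v≢r , ~-sym u~v , cong suc (≤-antisym (s≤s⁻¹ (min (u , proj₁ (proj₂ (level u)) , u~v))) (depth-minimal p)))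

    parent : Vertex n → Vertex n
    parent v = proj₁ (up v)

    parent-root : parent r ≡ r
    parent-root with up r
    ... | _ , inj₁ (_ , u≡r) = u≡r
    ... | _ , inj₂ (r≢r , _) = contradiction refl r≢r

    ~-parent : ∀ {v} → v ≢ r → v ~ parent v
    ~-parent {v} v≢r with up v
    ... | _ , inj₁ (v≡r , _)     = contradiction v≡r v≢r
    ... | _ , inj₂ (_ , v~u , _) = v~u

    depth-parent : ∀ {v} → v ≢ r → depth v ≡ suc (depth (parent v))
    depth-parent {v} v≢r with up v
    ... | _ , inj₁ (v≡r , _)     = contradiction v≡r v≢r
    ... | _ , inj₂ (_ , _ , d≡)  = d≡

  bfs-tree : ∀ r → SpanningTree r
  bfs-tree r = record { Levels r }

-- Graphs with at most two edges outside the tree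

module Sparse {m : ℕ} (H : Graph (suc m)) (saturated : IsC5SaturatedRelK4 H) (few : edgeCount H ≤ 4 * suc m + 1)
  (tree : Saturated.SpanningTree H saturated (zero , zero)) where

  open Saturated H saturated public
  open SpanningTree tree public

  V : Set
  V = Vertex (suc m)

  r : V
  r = zero , zero

  Alike : V × V → V × V → Set
  Alike e f = e ≡ f ⊎ e ≡ swap f

  _≟E_ : (e f : V × V) → Dec (e ≡ f)
  (a , b) ≟E (c , d) = map′ (λ (p , q) → cong₂ _,_ p q) (λ { refl → refl , refl }) ((a ≟V c) ×-dec (b ≟V d))

  alike? : ∀ e f → Alike e f ⊎ e ≄ f
  alike? e f with e ≟E f | e ≟E swap f
  ... | yes p | _     = inj₁ (inj₁ p)
  ... | no _  | yes q = inj₁ (inj₂ q)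
  ... | no p  | no q  = inj₂ (p , q)

  Extra : V × V → Set
  Extra (u , v) = u ~ v × parent u ≢ v × parent v ≢ u

  extra? : Decidable Extra
  extra? (u , v) = (u ~? v) ×-dec ¬? (parent u ≟V v) ×-dec ¬? (parent v ≟V u)

  no-2-cycle : ∀ {v w} → v ≢ r → w ≢ r → parent v ≡ w → parent w ≢ v
  no-2-cycle {v} {w} v≢r w≢r refl pp = m+1+n≢m (depth v) {1} (begin
    depth v + 2                                ≡⟨ +-comm (depth v) 2 ⟩
    suc (suc (depth v))                        ≡⟨ cong (λ x → suc (suc (depth x))) pp ⟨
    suc (suc (depth (parent (parent v))))      ≡⟨ cong suc (depth-parent w≢r) ⟨
    suc (depth (parent v))                     ≡⟨ depth-parent v≢r ⟨
    depth v                                    ∎)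
    where open ≡-Reasoning

  few-extras : ∀ {es} → AllPairs _≄_ es → All Extra es → length es ≤ 2
  few-extras {es} distinct extras = +-cancelˡ-≤ (4 * suc m) _ _ (begin
    4 * suc m + length es                        ≡⟨ cong (_+ length es) (length-vertices (suc m)) ⟨
    suc (length rest + length es)                ≡⟨ cong (λ k → suc (k + length es)) (length-map toParent rest) ⟨
    suc (length (map toParent rest) + length es) ≡⟨ cong suc (length-++ (map toParent rest)) ⟨
    suc (length (map toParent rest ++ es))       ≤⟨ s≤s (length≤edgeCount H H-sym (λ _ _ → proper) all-distinct all-edges) ⟩
    suc (edgeCount H)                            ≤⟨ s≤s few ⟩
    suc (4 * suc m + 1)                          ≡⟨ +-suc (4 * suc m) 1 ⟨
    4 * suc m + 2                                ∎)
    where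
    open ≤-Reasoning
    toParent : V → V × V
    toParent v = v , parent v

    -- The root `(zero , zero)` is the head of the vertex list, so the tree edges are indexed by its
    -- tail.
    split : ∃[ vs ] vertices (suc m) ≡ r ∷ vs
    split = _ , refl

    rest : List V
    rest = proj₁ split

    rest≢r : All (_≢ r) rest
    rest≢r with vertices-unique (suc m)
    ... | r∉ ∷ _ = All.map (_∘ sym) r∉

    rest-unique : Unique rest
    rest-unique with vertices-unique (suc m)
    ... | _ ∷ u = u

    tree-distinct : ∀ {vs} → All (_≢ r) vs → Unique vs → AllPairs _≄_ (map toParent vs)
    tree-distinct [] [] = []
    tree-distinct (v≢r ∷ ≢r) (v∉ ∷ unique) =
      All.map⁺ (All.zipWith (λ (w≢r , v≢w) → (v≢w ∘ cong proj₁) , λ e → no-2-cycle v≢r w≢r (cong proj₂ e) (sym (cong proj₁ e))) (≢r , v∉))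
      ∷ tree-distinct ≢r unique

    all-distinct : AllPairs _≄_ (map toParent rest ++ es)
    all-distinct = AllPairs.++⁺ (tree-distinct rest≢r rest-unique) distinct
      (All.map⁺ (All.universal (λ v → All.map (λ { (_ , p , q) → (λ { refl → p refl }) , (λ { refl → q refl }) }) extras) rest))

    all-edges : All (λ (u , v) → u ~ v) (map toParent rest ++ es)
    all-edges = All.++⁺ (All.map⁺ (All.map ~-parent rest≢r)) (All.map proj₁ extras)

  anyPair? : {P : V × V → Set} → Decidable P → Dec (∃ P)
  anyPair? P? = map′ (λ (u , v , p) → (u , v) , p) (λ ((u , v) , p) → u , v , p) (anyVertex? λ u → anyVertex? λ v → P? (u , v))

  ≄? : ∀ e f → Dec (e ≄ f)
  ≄? e f = ¬? (e ≟E f) ×-dec ¬? (e ≟E swap f)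

  -- Extra edges are picked greedily, and a third one would contradict `few-extras`. If fewer than
  -- two exist, `(r , r)` or a repetition fills the empty places; only the covering property is
  -- required of the pairs.
  extras : ∃[ e₁ ] ∃[ e₂ ] (∀ {e} → Extra e → Alike e e₁ ⊎ Alike e e₂)
  extras with anyPair? extra?
  ... | no none = (r , r) , (r , r) , λ x → contradiction (_ , x) none
  ... | yes (e₁ , x₁) with anyPair? (λ e → extra? e ×-dec ≄? e e₁)
  ... | no none = e₁ , e₁ , λ {e} x → [ inj₁ , (λ ≄ → contradiction (_ , x , ≄) none) ]′ (alike? e e₁)
  ... | yes (e₂ , x₂ , e₂≄e₁) = e₁ , e₂ , λ {e} x → case alike? e e₁ of λ
        { (inj₁ like) → inj₁ like
        ; (inj₂ e≄e₁) → case alike? e e₂ of λ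
          { (inj₁ like) → inj₂ like
          ; (inj₂ e≄e₂) → contradiction (few-extras ((e≄e₂ ∷ e≄e₁ ∷ []) ∷ (e₂≄e₁ ∷ []) ∷ [] ∷ []) (x ∷ x₂ ∷ x₁ ∷ [])) λ { (s≤s (s≤s ())) } } }

  module Kernel (e₁ e₂ : V × V) (covered : ∀ {e} → Extra e → Alike e e₁ ⊎ Alike e e₂) where

    -- An edge below the vertex φ i is charged to 2 + i, the two extra edges to 0 and 1; the vertex of
    -- least depth is never charged.
    sparse : ∀ {k es} (φ : ℕ → V) → 0 < k → (∀ {i j} → i < k → j < k → φ i ≡ φ j → i ≡ j) →
             All (λ (i , j) → i < k × j < k × φ i ~ φ j) es → AllPairs (λ e f → ¬ T (same e f)) es →
             length es ≤ suc k
    sparse {k} {es} φ 0<k φ-inj edges distinct = s≤s⁻¹ (subst (λ l → suc l ≤ _) (length-map charge es)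
      (unique-below {suc (suc μ) ∷ map charge es} (All.map⁺ (All.map (λ {e} p → μ-free e p ∘ sym) edges) ∷ charges-unique edges distinct)
        (s≤s (s≤s μ<k) ∷ All.map⁺ (All.map (λ {e} → charge< e) edges))))
      where
      lowest = minimum-at (depth ∘ φ) 0<k
      μ = proj₁ lowest
      μ<k = proj₁ (proj₂ lowest)

      E : ℕ × ℕ → Set
      E (i , j) = i < k × j < k × φ i ~ φ j

      charge : ℕ × ℕ → ℕ
      charge (i , j) with parent (φ i) ≟V φ j | parent (φ j) ≟V φ i | alike? (φ i , φ j) e₁
      ... | yes _ | _     | _      = suc (suc i)
      ... | no _  | yes _ | _      = suc (suc j)
      ... | no _  | no _  | inj₁ _ = 0
      ... | no _  | no _  | inj₂ _ = 1

      data Charge (i j : ℕ) : ℕ → Set where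
        left  : parent (φ i) ≡ φ j → Charge i j (suc (suc i))
        right : parent (φ j) ≡ φ i → Charge i j (suc (suc j))
        one   : Alike (φ i , φ j) e₁ → Charge i j 0
        two   : Alike (φ i , φ j) e₂ → Charge i j 1

      charged : ∀ e → E e → Charge (proj₁ e) (proj₂ e) (charge e)
      charged (i , j) (_ , _ , i~j) with parent (φ i) ≟V φ j | parent (φ j) ≟V φ i | alike? (φ i , φ j) e₁
      ... | yes p | _     | _       = left p
      ... | no _  | yes p | _       = right p
      ... | no _  | no _  | inj₁ l  = one l
      ... | no p  | no q  | inj₂ (≢ , ≢′) with covered (i~j , p , q)
      ... | inj₁ (inj₁ l) = contradiction l ≢
      ... | inj₁ (inj₂ l) = contradiction l ≢′
      ... | inj₂ l        = two l

      charge< : ∀ e → E e → charge e < suc (suc k)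
      charge< e@(i , j) p@(i< , j< , _) with charge e | charged e p
      ... | _ | left _  = s≤s (s≤s i<)
      ... | _ | right _ = s≤s (s≤s j<)
      ... | _ | one _   = z<s
      ... | _ | two _   = s≤s z<s

      -- The end to which a tree edge is charged has its parent among the vertices `φ j` as well,
      -- and that parent has smaller depth.
      not-lowest : ∀ {i j} → i < k → j < k → φ i ~ φ j → parent (φ i) ≡ φ j → i ≢ μ
      not-lowest {i} {j} i< j< i~j p refl = 1+n≰n (begin
        suc (depth (φ j))            ≡⟨ cong (λ v → suc (depth v)) p ⟨
        suc (depth (parent (φ μ)))   ≡⟨ depth-parent not-root ⟨
        depth (φ μ)                  ≤⟨ proj₂ (proj₂ lowest) j< ⟩
        depth (φ j)                  ∎)
        where
        open ≤-Reasoning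
        not-root : φ μ ≢ r
        not-root μ≡r = ~⇒≢ i~j (trans μ≡r (trans (sym parent-root) (trans (cong parent (sym μ≡r)) p)))

      μ-free : ∀ e → E e → charge e ≢ suc (suc μ)
      μ-free e@(i , j) p@(i< , j< , i~j) with charge e | charged e p
      ... | _ | left q  = not-lowest i< j< i~j q ∘ suc-injective ∘ suc-injective
      ... | _ | right q = not-lowest j< i< (~-sym i~j) q ∘ suc-injective ∘ suc-injective
      ... | _ | one _   = λ ()
      ... | _ | two _   = λ ()

      same-refl : ∀ i j → T (same (i , j) (i , j))
      same-refl i j = Equivalence.from T-∨ (inj₁ (Equivalence.from T-∧ (≡⇒≡ᵇ i i refl , ≡⇒≡ᵇ j j refl)))

      same-swap : ∀ i j → T (same (i , j) (j , i))
      same-swap i j = Equivalence.from (T-∨ {(i ≡ᵇ j) ∧ (j ≡ᵇ i)}) (inj₂ (Equivalence.from T-∧ (≡⇒≡ᵇ i i refl , ≡⇒≡ᵇ j j refl)))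

      alike⇒same : ∀ {i j i′ j′} → E (i , j) → E (i′ , j′) → Alike (φ i , φ j) (φ i′ , φ j′) → T (same (i , j) (i′ , j′))
      alike⇒same {i} {j} (i< , j< , _) (i′< , j′< , _) (inj₁ e) with φ-inj i< i′< (cong proj₁ e) | φ-inj j< j′< (cong proj₂ e)
      ... | refl | refl = same-refl i j
      alike⇒same {i} {j} (i< , j< , _) (i′< , j′< , _) (inj₂ e) with φ-inj i< j′< (cong proj₁ e) | φ-inj j< i′< (cong proj₂ e)
      ... | refl | refl = same-swap i j

      alike-common : ∀ {e f g : V × V} → Alike e g → Alike f g → Alike e f
      alike-common (inj₁ refl) (inj₁ refl) = inj₁ refl
      alike-common (inj₁ refl) (inj₂ refl) = inj₂ refl
      alike-common (inj₂ refl) (inj₁ refl) = inj₂ refl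
      alike-common (inj₂ refl) (inj₂ refl) = inj₁ refl

      same-charge : ∀ {i j i′ j′ c} → E (i , j) → E (i′ , j′) → Charge i j c → Charge i′ j′ c → Alike (φ i , φ j) (φ i′ , φ j′)
      same-charge _ _ (left p)  (left q)  = inj₁ (cong₂ _,_ refl (trans (sym p) q))
      same-charge _ _ (left p)  (right q) = inj₂ (cong₂ _,_ refl (trans (sym p) q))
      same-charge _ _ (right p) (left q)  = inj₂ (cong₂ _,_ (trans (sym p) q) refl)
      same-charge _ _ (right p) (right q) = inj₁ (cong₂ _,_ (trans (sym p) q) refl)
      same-charge _ _ (one l)   (one l′)  = alike-common l l′
      same-charge _ _ (two l)   (two l′)  = alike-common l l′

      charge-injective : ∀ e f → E e → E f → charge e ≡ charge f → T (same e f)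
      charge-injective e f p q c = alike⇒same p q (same-charge p q (charged e p) (subst (Charge _ _) (sym c) (charged f q)))

      charges-unique : ∀ {es} → All E es → AllPairs (λ e f → ¬ T (same e f)) es → Unique (map charge es)
      charges-unique [] [] = []
      charges-unique {e ∷ _} (p ∷ ps) (d ∷ ds) =
        All.map⁺ (All.zipWith (λ {f} (q , ¬same) c → ¬same (charge-injective e f p q c)) (ps , d)) ∷ charges-unique ps ds

    -- Inner vertices, and an outer vertex in every part

    ancestor : ℕ → V → V
    ancestor zero    v = v
    ancestor (suc k) v = parent (ancestor k v)

    ancestor-+ : ∀ j k v → ancestor (j + k) v ≡ ancestor j (ancestor k v)
    ancestor-+ zero    k v = refl
    ancestor-+ (suc j) k v = cong parent (ancestor-+ j k v)

    depth-zero : ∀ {v} → depth v ≡ 0 → v ≡ r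
    depth-zero {v} d with v ≟V r
    ... | yes v≡r = v≡r
    ... | no v≢r  = contradiction (trans (sym d) (depth-parent v≢r)) λ ()

    depth-ancestor : ∀ k v → depth (ancestor k v) ≡ depth v ∸ k
    depth-ancestor zero    v = refl
    depth-ancestor (suc k) v with ancestor k v ≟V r | depth-ancestor k v
    ... | no ≢r  | d = trans (cong pred (trans (sym (depth-parent ≢r)) d)) (pred[m∸n]≡m∸[1+n] (depth v) k)
    ... | yes ≡r | d = begin
      depth (parent (ancestor k v))  ≡⟨ cong (λ w → depth (parent w)) ≡r ⟩
      depth (parent r)               ≡⟨ cong depth parent-root ⟩
      depth r                        ≡⟨ depth-root ⟩
      0                              ≡⟨ cong pred (trans (sym depth-root) (trans (cong depth (sym ≡r)) d)) ⟩
      pred (depth v ∸ k)    ≡⟨ pred[m∸n]≡m∸[1+n] (depth v) k ⟩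
      depth v ∸ suc k                ∎
      where open ≡-Reasoning

    ancestor-5 : ∀ v → ancestor 5 v ≡ r
    ancestor-5 v = depth-zero (trans (depth-ancestor 5 v) (m≤n⇒m∸n≡0 (depth≤5 v)))

    endpoint : Fin 4 → V
    endpoint zero                   = proj₁ e₁
    endpoint (suc zero)             = proj₂ e₁
    endpoint (suc (suc zero))       = proj₁ e₂
    endpoint (suc (suc (suc zero))) = proj₂ e₂

    -- Six ancestors per endpoint suffice, because depths are at most 5 and the fifth ancestor is
    -- always the root. The finite range makes the notion decidable.
    Inner : V → Set
    Inner v = ∃[ j ] ∃[ k ] ancestor (toℕ {6} k) (endpoint j) ≡ v

    inner? : Decidable Inner
    inner? v = Fin.any? λ j → Fin.any? λ k → ancestor (toℕ k) (endpoint j) ≟V v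

    inner-root : Inner r
    inner-root = zero , Fin.fromℕ 5 , ancestor-5 _

    inner-parent : ∀ {v} → Inner v → Inner (parent v)
    inner-parent (j , k , refl) with toℕ k ≟ 5
    ... | yes k≡5 = subst Inner (sym (trans (cong (λ k → parent (ancestor k (endpoint j))) k≡5)
        (trans (cong parent (ancestor-5 (endpoint j))) parent-root))) inner-root
    ... | no k≢5  = j , Fin.fromℕ< 1+k<6 , cong (λ k → ancestor k (endpoint j)) (Fin.toℕ-fromℕ< 1+k<6)
      where
      1+k<6 : suc (toℕ k) < 6
      1+k<6 = s≤s (≤∧≢⇒< (s≤s⁻¹ (Fin.toℕ<n k)) k≢5)

    extra-inner : ∀ {u v} → Extra (u , v) → Inner u
    extra-inner x with covered x
    ... | inj₁ (inj₁ refl) = zero , zero , refl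
    ... | inj₁ (inj₂ refl) = suc zero , zero , refl
    ... | inj₂ (inj₁ refl) = suc (suc zero) , zero , refl
    ... | inj₂ (inj₂ refl) = suc (suc (suc zero)) , zero , refl

    -- Only depths 1..4 occur in a part other than that of the root, only 2..5 in the part of the
    -- root; consecutive ancestors lie in different parts, so each of the four chains of ancestors
    -- meets a part at most twice outside the root.
    shift : Fin 4 → ℕ
    shift i = if ⌊ i Fin.≟ zero ⌋ then 2 else 1

    level-bound : ∀ v → v ≢ r → shift (proj₁ v) ≤ depth v × depth v < 4 + shift (proj₁ v)
    level-bound v v≢r with proj₁ v Fin.≟ zero
    ... | no v≢0 = subst (1 ≤_) (sym (depth-parent v≢r)) (s≤s z≤n) , s≤s (depth≤4 (v≢0 ∘ sym))
    ... | yes v≡0 = subst (2 ≤_) (sym (depth-parent v≢r)) (s≤s (n≢0⇒n>0 parent≢0)) , s≤s (depth≤5 v)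
      where
      parent≢0 : depth (parent v) ≢ 0
      parent≢0 d = proper (~-parent v≢r) (trans v≡0 (cong proj₁ (sym (depth-zero d))))

    -- The four depths possible in a part, shifted to 0, ..., 3, are grouped into two pairs of
    -- consecutive depths, so depths in the same group differ by at most one.
    half : ℕ → Fin 2
    half d = if ⌊ d <? 2 ⌋ then zero else suc zero

    half-close : ∀ {a b} → a < 4 → b < 4 → half a ≡ half b → a ≡ b ⊎ a ≡ suc b ⊎ b ≡ suc a
    half-close {0} {0} _ _ _ = inj₁ refl
    half-close {0} {1} _ _ _ = inj₂ (inj₂ refl)
    half-close {1} {0} _ _ _ = inj₂ (inj₁ refl)
    half-close {1} {1} _ _ _ = inj₁ refl
    half-close {2} {2} _ _ _ = inj₁ refl
    half-close {2} {3} _ _ _ = inj₂ (inj₂ refl)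
    half-close {3} {2} _ _ _ = inj₂ (inj₁ refl)
    half-close {3} {3} _ _ _ = inj₁ refl
    half-close {0} {suc (suc _)} _ _ ()
    half-close {1} {suc (suc _)} _ _ ()
    half-close {suc (suc _)} {0} _ _ ()
    half-close {suc (suc _)} {1} _ _ ()
    half-close {suc (suc (suc (suc _)))} (s≤s (s≤s (s≤s (s≤s ())))) _ _
    half-close {_} {suc (suc (suc (suc _)))} _ (s≤s (s≤s (s≤s (s≤s ())))) _

    depth-chain : ∀ k u → ancestor k u ≢ r → depth u ≡ k + depth (ancestor k u)
    depth-chain zero    u _ = refl
    depth-chain (suc k) u ≢r = begin
      depth u                                     ≡⟨ depth-chain k u ≢r′ ⟩
      k + depth (ancestor k u)                    ≡⟨ cong (k +_) (depth-parent ≢r′) ⟩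
      k + suc (depth (ancestor (suc k) u))        ≡⟨ +-suc k _ ⟩
      suc k + depth (ancestor (suc k) u)          ∎
      where
      open ≡-Reasoning
      ≢r′ : ancestor k u ≢ r
      ≢r′ e = ≢r (trans (cong parent e) parent-root)

    -- The number of steps along a chain equals the difference of the depths. Close depths therefore
    -- leave at most one step, and one step changes the part.
    chain-close : ∀ k u → ancestor k u ≢ r → proj₁ u ≡ proj₁ (ancestor k u) →
                  let v = ancestor k u in depth u ≡ depth v ⊎ depth u ≡ suc (depth v) ⊎ depth v ≡ suc (depth u) → u ≡ v
    chain-close k u v≢r same-part close with depth-chain k u v≢r
    chain-close 0 u _ _ _ | _ = refl
    chain-close 1 u v≢r same-part _ | _ =
      contradiction same-part (proper (~-parent λ u≡r → v≢r (trans (cong parent u≡r) parent-root)))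
    chain-close (suc (suc k)) u v≢r _ (inj₁ e)        | d = contradiction (trans (sym e) d) (m≢1+n+m _)
    chain-close (suc (suc k)) u v≢r _ (inj₂ (inj₁ e)) | d = contradiction (suc-injective (trans (sym e) d)) (m≢1+n+m _)
    chain-close (suc (suc k)) u v≢r _ (inj₂ (inj₂ e)) | d = contradiction (trans e (cong suc d)) (m≢1+n+m _)

    slot : V → Fin 2
    slot v = half (depth v ∸ shift (proj₁ v))

    Close : ℕ → ℕ → Set
    Close a b = a ≡ b ⊎ a ≡ suc b ⊎ b ≡ suc a

    Close-+ : ∀ s {a b} → Close a b → Close (a + s) (b + s)
    Close-+ s (inj₁ e)        = inj₁ (cong (_+ s) e)
    Close-+ s (inj₂ (inj₁ e)) = inj₂ (inj₁ (cong (_+ s) e))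
    Close-+ s (inj₂ (inj₂ e)) = inj₂ (inj₂ (cong (_+ s) e))

    shifted-close : ∀ s {a b} → s ≤ a × a < 4 + s → s ≤ b × b < 4 + s → half (a ∸ s) ≡ half (b ∸ s) → Close a b
    shifted-close s (s≤a , a<) (s≤b , b<) e =
      subst₂ Close (m∸n+n≡m s≤a) (m∸n+n≡m s≤b) (Close-+ s (half-close (small a< s≤a) (small b< s≤b) e))
      where
      small : ∀ {a} → a < 4 + s → s ≤ a → a ∸ s < 4
      small a< s≤a = +-cancelʳ-< s _ 4 (subst (_< 4 + s) (sym (m∸n+n≡m s≤a)) a<)

    slot-close : ∀ {u v} → u ≢ r → v ≢ r → proj₁ u ≡ proj₁ v → slot u ≡ slot v → Close (depth u) (depth v)
    slot-close {i , a} {_ , b} u≢r v≢r refl = shifted-close (shift i) (level-bound (i , a) u≢r) (level-bound (i , b) v≢r)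

    -- One code for the root and 4 · 2 codes for a chain together with a group of depths. If all
    -- vertices of a part were inner, this would inject `Fin (suc m)` into `Fin 9`.
    code : ∀ {v} → Inner v → Fin 9
    code {v} (j , _) = if ⌊ v ≟V r ⌋ then zero else suc (combine j (slot v))

    same-chain : ∀ {l u v} k k′ → ancestor k l ≡ u → ancestor k′ l ≡ v → k ≤ k′ → u ≢ r → v ≢ r →
                 proj₁ u ≡ proj₁ v → slot u ≡ slot v → u ≡ v
    same-chain {l} {u} {v} k k′ refl refl k≤k′ u≢r v≢r same-part e =
      trans (chain-close (k′ ∸ k) u (v≢r ∘ trans (sym v≡)) (trans same-part (cong proj₁ (sym v≡)))
              (subst (λ w → Close (depth u) (depth w)) (sym v≡) (slot-close u≢r v≢r same-part e)))
            v≡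
      where
      v≡ : ancestor (k′ ∸ k) u ≡ v
      v≡ = trans (sym (ancestor-+ (k′ ∸ k) k l)) (cong (λ k → ancestor k l) (m∸n+n≡m k≤k′))

    code-injective : ∀ {u v} (p : Inner u) (q : Inner v) → proj₁ u ≡ proj₁ v → code p ≡ code q → u ≡ v
    code-injective {u} {v} (j , k , p) (j′ , k′ , q) same-part e with u ≟V r | v ≟V r
    ... | yes u≡r | yes v≡r = trans u≡r (sym v≡r)
    ... | no u≢r  | no v≢r with Fin.combine-injective j (slot u) j′ (slot v) (Fin.suc-injective e) | ≤-total (toℕ k) (toℕ k′)
    ... | refl , s | inj₁ k≤k′ = same-chain (toℕ k) (toℕ k′) p q k≤k′ u≢r v≢r same-part s
    ... | refl , s | inj₂ k′≤k = sym (same-chain (toℕ k′) (toℕ k) q p k′≤k v≢r u≢r (sym same-part) (sym s))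

    abstract
      outer : 10 ≤ suc m → ∀ i → ∃[ v ] (proj₁ v ≡ i × ¬ Inner v)
      outer 10≤n i with Fin.any? (λ j → ¬? (inner? (i , j)))
      ... | yes (j , ¬inner) = (i , j) , refl , ¬inner
      ... | no none = contradiction (≤-trans 10≤n (Fin.injective⇒≤ λ {a} {b} e → cong proj₂ (code-injective (inner a) (inner b) refl e))) 1+n≰n
        where
        inner : ∀ j → Inner (i , j)
        inner j = decidable-stable (inner? (i , j)) (λ ¬inner → none (j , ¬inner))

    -- The tree below the inner vertices

    Down : V → V → Set
    Down u v = ¬ Inner u × parent v ≡ u

    outer≢root : ∀ {v} → ¬ Inner v → v ≢ r
    outer≢root ¬inner refl = ¬inner inner-root

    up-or-down : ∀ {u v} → ¬ Inner u → u ~ v → v ≡ parent u ⊎ Down u v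
    up-or-down {u} {v} ¬inner u~v with parent u ≟V v | parent v ≟V u
    ... | yes p | _     = inj₁ (sym p)
    ... | no _  | yes q = inj₂ (¬inner , q)
    ... | no p  | no q  = contradiction (extra-inner (u~v , p , q)) ¬inner

    Down-outer : ∀ {u v} → Down u v → ¬ Inner v
    Down-outer (¬inner , refl) = ¬inner ∘ inner-parent

    Down-depth : ∀ {u v} → Down u v → depth v ≡ suc (depth u)
    Down-depth d@(_ , refl) = depth-parent (outer≢root (Down-outer d))

    -- Children of outer vertices are outer and carry no extra edges. A path that has once descended
    -- from an outer vertex can therefore only keep descending.
    next : ∀ {u v w} → Down u v → v ~ w → u ≢ w → Down v w
    next d@(_ , refl) v~w u≢w with up-or-down (Down-outer d) v~w
    ... | inj₁ w≡ = contradiction (sym w≡) u≢w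
    ... | inj₂ d′ = d′

    Below : ℕ → V → V → Set
    Below k u v = depth v ≡ k + depth u

    step : ∀ {k u v w} → Below k u v → Down v w → Below (suc k) u w
    step e d = trans (Down-depth d) (cong suc e)

    not-below : ∀ {k u v} → ¬ Inner u → u ~ v → ¬ Below (2 + k) u v
    not-below {k} {u} {v} ¬inner u~v below with up-or-down ¬inner u~v
    ... | inj₁ refl = m≢1+n+m (depth v) (trans below (cong (2 +_) (trans (cong (k +_) (depth-parent (outer≢root ¬inner))) (+-suc k _))))
    ... | inj₂ d = m≢1+n+m (depth u) (suc-injective (trans (sym (Down-depth d)) below))

    -- A path between two neighbours of x that avoids x would have to come back up from below x.
    same-part : ∀ {x u w} → ¬ Inner x → x ~ u → x ~ w → proj₁ u ≡ proj₁ w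
    same-part {x} {u} {w} ¬inner x~u x~w = decidable-stable (proj₁ u Fin.≟ proj₁ w) λ uw →
      case up-or-down ¬inner x~u of λ
        { (inj₂ x↓u) → below uw x↓u x~w
        ; (inj₁ u≡) → case up-or-down ¬inner x~w of λ
          { (inj₂ x↓w) → below (uw ∘ sym) x↓w x~u
          ; (inj₁ w≡) → uw (cong proj₁ (trans u≡ (sym w≡))) } }
      where
      below : ∀ {u w} → KAdj u w → Down x u → x ~ w → ⊥
      below {u} {w} uw x↓u x~w with linked uw
      ... | inj₁ u~w = not-below ¬inner x~w (step (Down-depth x↓u) (next x↓u u~w (~⇒≢ x~w)))
      ... | inj₂ (path₄ {a} {b} {c} u~a a~b b~c c~w u≢b u≢c a≢c a≢w b≢w) with x ≟V a
      ... | no x≢a = not-below ¬inner x~w (step (step (step (step (Down-depth x↓u) u↓a) a↓b) b↓c) c↓w)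
        where
        u↓a = next x↓u u~a x≢a
        a↓b = next u↓a a~b u≢b
        b↓c = next a↓b b~c a≢c
        c↓w = next b↓c c~w b≢w
      -- The path may also begin by stepping from `u` back to `x`. It then descends from `x` for
      -- good, or rises to `parent x`; in the latter case `w` is a child of `x`, and reading the
      -- path backwards from `w` puts `parent x` below `x`.
      ... | yes refl with up-or-down ¬inner a~b
      ... | inj₂ x↓b = not-below ¬inner x~w (step (step (Down-depth x↓b) b↓c) (next b↓c c~w b≢w))
        where b↓c = next x↓b b~c a≢c
      ... | inj₁ b≡ with up-or-down ¬inner x~w
      ... | inj₁ w≡ = b≢w (trans b≡ (sym w≡))
      ... | inj₂ x↓w = not-below ¬inner a~b (step (step (Down-depth x↓w) w↓c) (next w↓c (~-sym b~c) (b≢w ∘ sym)))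
        where w↓c = next x↓w (~-sym c~w) a≢c

    -- Suppose `x`, its parent `y` and its grandparent `z` are all outer, and let `t` be the parent
    -- of `z`. Then `x` and `z`, as neighbours of `y`, share a part, so `x` and `t` do not. The only
    -- path from `x` to `t` follows the tree and has length three, so there is neither an edge nor a
    -- path of length four.
    shallow : ∀ v → Inner (parent (parent v))
    shallow x = decidable-stable (inner? z) λ ¬inner-z →
      too-deep ¬inner-z (¬inner-z ∘ inner-parent) (¬inner-z ∘ inner-parent ∘ inner-parent)
      where
      y = parent x
      z = parent y
      t = parent z
      too-deep : ¬ Inner z → ¬ Inner y → ¬ Inner x → ⊥
      too-deep ¬z ¬y ¬x = go (linked {x} {t} (proper (~-parent (outer≢root ¬z)) ∘ trans (sym x≡z)))
        where
        x≡z : proj₁ x ≡ proj₁ z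
        x≡z = same-part ¬y (~-sym (~-parent (outer≢root ¬x))) (~-parent (outer≢root ¬y))
        x-t : Below 3 t x
        x-t = trans (depth-parent (outer≢root ¬x)) (cong suc (trans (depth-parent (outer≢root ¬y)) (cong suc (depth-parent (outer≢root ¬z)))))
        y-t : Below 2 t y
        y-t = suc-injective (trans (sym (depth-parent (outer≢root ¬x))) x-t)
        z-t : Below 1 t z
        z-t = suc-injective (trans (sym (depth-parent (outer≢root ¬y))) y-t)
        never : ∀ {j k u} → Below k t u → ¬ Below (suc j) u t
        never {j} {k} e e′ = m≢1+n+m (depth t) (trans e′ (trans (cong (suc j +_) e) (sym (+-assoc (suc j) k _))))
        go : x ~ t ⊎ Path₄ x t → ⊥
        go (inj₁ x~t) with up-or-down ¬x x~t
        ... | inj₁ t≡y = m≢1+n+m (depth t) (trans (cong depth t≡y) y-t)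
        ... | inj₂ x↓t = never x-t (Down-depth x↓t)
        go (inj₂ (path₄ {a} {b} {c} x~a a~b b~c c~t x≢b x≢c a≢c a≢t b≢t)) with up-or-down ¬x x~a
        ... | inj₂ x↓a = never x-t (step (step (step (Down-depth x↓a) a↓b) b↓c) (next b↓c c~t b≢t))
          where
          a↓b = next x↓a a~b x≢b
          b↓c = next a↓b b~c a≢c
        ... | inj₁ refl with up-or-down ¬y a~b
        ... | inj₂ y↓b = never y-t (step (step (Down-depth y↓b) b↓c) (next b↓c c~t b≢t))
          where b↓c = next y↓b b~c a≢c
        ... | inj₁ refl with up-or-down ¬z b~c
        ... | inj₁ refl = ~⇒≢ c~t refl
        ... | inj₂ z↓c = never z-t (step (Down-depth z↓c) (next z↓c c~t b≢t))

    no-grandchild : ∀ {x a b} → Down x a → ¬ Down a b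
    no-grandchild (¬x , refl) (_ , refl) = ¬x (shallow _)

    -- A first step from `x` to a child would have to be followed by a step to a grandchild of an
    -- outer vertex, and `shallow` leaves no such vertex.
    pendant-path : ∀ {x w} → ¬ Inner x → KAdj x w → w ≢ parent x → parent w ≢ x →
                   ∃[ path ] (Path₄.a {x} {w} path ≡ parent x)
    pendant-path {x} {w} ¬x xw w≢ ¬child with linked xw
    ... | inj₁ x~w = case up-or-down ¬x x~w of λ { (inj₁ e) → contradiction e w≢ ; (inj₂ (_ , e)) → contradiction e ¬child }
    ... | inj₂ path@(path₄ x~a a~b b~c c~w x≢b x≢c a≢c a≢w b≢w) with up-or-down ¬x x~a
    ... | inj₁ a≡ = path , a≡
    ... | inj₂ x↓a = contradiction (next x↓a a~b x≢b) (no-grandchild x↓a)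

    -- The vertices that are not leaves hanging at distance two from the inner ones.
    Near : V → Set
    Near v = Inner (parent v)

    -- A vertex that is not near has its parent as its only neighbour and so is never interior to a
    -- path. Hence the search may be confined to near vertices without losing any path between them.
    near-interior : ∀ {a z b} → a ~ z → z ~ b → a ≢ b → Near z
    near-interior {a} {z} {b} a~z z~b a≢b = decidable-stable (inner? (parent z)) λ ¬near →
      let ¬z = ¬near ∘ inner-parent
          leaf : ∀ {v} → z ~ v → v ≡ parent z
          leaf z~v = [ (λ e → e) , (λ (_ , e) → contradiction (subst (Inner ∘ parent) e (shallow _)) ¬near) ]′ (up-or-down ¬z z~v)
      in a≢b (trans (leaf (~-sym a~z)) (sym (leaf z~b)))

    open Paths _~_ Near

    Path₄⇒SPath : ∀ {u w} → Path₄ u w → SPath 3 u w (u ∷ [])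
    Path₄⇒SPath (path₄ u~a a~b b~c c~w u≢b u≢c a≢c a≢w b≢w) =
      _ , u~a , near-interior u~a a~b u≢b , a≢w , (λ { (here refl) → ~⇒≢ u~a refl }) ,
      _ , a~b , near-interior a~b b~c a≢c , b≢w , (λ { (here refl) → ~⇒≢ a~b refl ; (there (here refl)) → u≢b refl }) ,
      _ , b~c , near-interior b~c c~w b≢w , ~⇒≢ c~w ,
        (λ { (here refl) → ~⇒≢ b~c refl ; (there (here refl)) → a≢c refl ; (there (there (here refl))) → u≢c refl }) ,
      c~w

    SPath⇒Path₄ : ∀ {u w} → SPath 3 u w (u ∷ []) → Path₄ u w
    SPath⇒Path₄ (_ , u~a , _ , a≢w , _ , _ , a~b , _ , b≢w , b∉ , _ , b~c , _ , _ , c∉ , c~w) =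
      path₄ u~a a~b b~c c~w (λ e → b∉ (there (here (sym e))))
        (λ e → c∉ (there (there (here (sym e))))) (λ e → c∉ (there (here (sym e)))) a≢w b≢w

    saturation : (f : Fin 4 → Fin 4) → (∀ {i j} → f i ≡ f j → i ≡ j) → Saturation 3 _~_ Near (λ v → toℕ (f (proj₁ v)))
    saturation f f-inj = record
      { decEq = _≟V_
      ; ~-sym = ~-sym
      ; proper = λ u~v e → proper u~v (f-inj (Fin.toℕ-injective e))
      ; colour<4 = λ v → Fin.toℕ<n (f (proj₁ v))
      ; noCycle = λ u~v p → no-chord u~v (SPath⇒Path₄ p)
      ; linked = λ _ _ c≢ → [ inj₁ , inj₂ ∘ Path₄⇒SPath ]′ (linked (λ e → c≢ (cong (toℕ ∘ f) e)))
      ; sparse = sparse }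

    -- This is what `Near` is needed for: it prevents `w` from being a child of `x`, the case in
    -- which no path through `parent x` is guaranteed.
    pendant₂ : ∀ {x w} → ¬ Inner x → Near w → KAdj x w → w ≢ parent x → SPath 2 (parent x) w (parent x ∷ [])
    pendant₂ {w = w} ¬x near xw w≢ with pendant-path {w = w} ¬x xw w≢ (λ e → ¬x (subst Inner e near))
    ... | path₄ x~a a~b b~c c~w x≢b x≢c a≢c a≢w b≢w , refl =
      _ , a~b , near-interior a~b b~c a≢c , b≢w , (λ { (here refl) → ~⇒≢ a~b refl }) ,
      _ , b~c , near-interior b~c c~w b≢w , ~⇒≢ c~w , (λ { (here refl) → ~⇒≢ b~c refl ; (there (here refl)) → a≢c refl }) , c~w

    -- The forced first step applies at both ends: the vertex before `y` cannot be a child of `y`,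
    -- as the vertex before that would be a grandchild.
    two-pendants : ∀ {x y} → ¬ Inner x → Near x → ¬ Inner y → Near y → KAdj x y →
                   parent x ≢ parent y × SPath 1 (parent x) (parent y) (parent x ∷ [])
    two-pendants {x} {y} ¬x near-x ¬y near-y xy
      with pendant-path {w = y} ¬x xy (λ e → ¬y (subst Inner (sym e) near-x)) (λ e → ¬x (subst Inner e near-y))
    ... | path₄ x~a a~b b~c c~y x≢b x≢c a≢c a≢y b≢y , refl with up-or-down ¬y (~-sym c~y)
    ... | inj₁ refl = a≢c , _ , a~b , near-interior a~b b~c a≢c , ~⇒≢ b~c , (λ { (here refl) → ~⇒≢ a~b refl }) , b~c
    ... | inj₂ y↓c = contradiction (next y↓c (~-sym b~c) (b≢y ∘ sym)) (no-grandchild y↓c)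

    -- An outer vertex at distance two from the inner ones

    module Deep {x : V} (¬u : ¬ Inner (parent x)) where

      u = parent x
      c₀ = parent u

      ¬x : ¬ Inner x
      ¬x = ¬u ∘ inner-parent

      x~u : x ~ u
      x~u = ~-parent (outer≢root ¬x)

      u~c₀ : u ~ c₀
      u~c₀ = ~-parent (outer≢root ¬u)

      part-c₀ : proj₁ c₀ ≡ proj₁ x
      part-c₀ = same-part ¬u u~c₀ (~-sym x~u)

      -- The first two steps are forced, from `x` to `u` and on to `c₀`: turning down at `u` would
      -- again require a grandchild of an outer vertex.
      deep-path : ∀ {w} → KAdj x w → w ≢ u → SPath 1 c₀ w (c₀ ∷ [])
      deep-path {w} xw w≢u with pendant-path {w = w} ¬x xw w≢u (λ e → ¬u (subst (Inner ∘ parent) e (shallow w)))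
      ... | path₄ x~a a~b b~c c~w x≢b x≢c a≢c a≢w b≢w , refl with up-or-down ¬u a~b
      ... | inj₁ refl = _ , b~c , near-interior b~c c~w b≢w , ~⇒≢ c~w , (λ { (here refl) → ~⇒≢ b~c refl }) , c~w
      ... | inj₂ u↓b = contradiction (next u↓b b~c a≢c) (no-grandchild u↓b)

      -- If the parent `v` of `y` were outer too, the deep path from `c₀` to `y` would pass through
      -- `v`. Then `c₀` and `y` are neighbours of the outer vertex `v` and share a part, which is
      -- the part of `x`.
      near : ∀ {y} → ¬ Inner y → KAdj x y → Near y
      near {y} ¬y xy = decidable-stable (inner? (parent y)) λ ¬v → both-deep ¬v
        where
        v = parent y
        both-deep : ¬ Inner v → ⊥
        both-deep ¬v with deep-path {y} xy (λ e → ¬v (subst (Inner ∘ parent) (sym e) (shallow x)))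
        ... | d , c₀~d , _ , _ , _ , d~y with up-or-down ¬y (~-sym d~y)
        ... | inj₂ (_ , refl) = ¬v (shallow _)
        ... | inj₁ refl = xy (trans (sym part-c₀) (same-part ¬v (~-sym c₀~d) (~-sym (~-parent (outer≢root ¬y)))))

      -- The single interior vertex between `c₀` and `y` must be `parent y`; were it a child of `y`,
      -- its neighbour `c₀` would be outer.
      adjacent-to : ∀ {y} → ¬ Inner y → KAdj x y → y ≢ u → c₀ ~ parent y
      adjacent-to {y} ¬y xy y≢u with deep-path {y} xy y≢u
      ... | d , c₀~d , _ , _ , _ , d~y with up-or-down ¬y (~-sym d~y)
      ... | inj₁ refl = c₀~d
      ... | inj₂ y↓d = contradiction (shallow x) (Down-outer (next y↓d (~-sym c₀~d) (λ e → ¬y (subst Inner (sym e) (shallow x)))))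

    -- Four outer vertices and the contradiction

    module Conclusion (10≤n : 10 ≤ suc m) where

      x : Fin 4 → V
      x i = proj₁ (outer 10≤n i)

      part-x : ∀ i → proj₁ (x i) ≡ i
      part-x i = proj₁ (proj₂ (outer 10≤n i))

      ¬x : ∀ i → ¬ Inner (x i)
      ¬x i = proj₂ (proj₂ (outer 10≤n i))

      x-adj : ∀ {i} w → proj₁ w ≢ i → KAdj (x i) w
      x-adj {i} w w≢i e = w≢i (trans (sym e) (part-x i))

      x-adj-x : ∀ {i j} → i ≢ j → KAdj (x i) (x j)
      x-adj-x {i} {j} i≢j = x-adj (x j) (λ e → i≢j (trans (sym e) (part-x j)))

      c : Fin 4 → V
      c i = parent (x i)

      part-c : ∀ i → proj₁ (c i) ≢ i
      part-c i e = proper (~-parent (outer≢root (¬x i))) (trans (part-x i) (sym e))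

      abstract
        fresh : ∀ i (vs : List V) → length vs ≤ 3 → ∃[ y ] (proj₁ y ≡ i × y ∉ vs)
        fresh i vs few-vs with Fin.any? (λ j → ¬? (Any.any? ((i , j) ≟V_) vs))
        ... | yes (j , ∉vs) = (i , j) , refl , ∉vs
        ... | no none = contradiction (begin
          4                                     ≤⟨ s≤s (s≤s (s≤s (s≤s z≤n))) ⟩
          10                                    ≤⟨ 10≤n ⟩
          suc m                                 ≡⟨ trans (length-map (i ,_) (allFin (suc m))) (length-tabulate {n = suc m} id) ⟨
          length (map (i ,_) (allFin (suc m)))  ≤⟨ length≤sum (λ _ → 1)
                                                     (Unique.map⁺ {f = i ,_} (λ e → cong proj₂ e) (Unique.allFin⁺ (suc m))) covers (All.universal (λ _ → ≤-refl) _) ⟩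
          _                                     ≡⟨ sum-ones vs ⟩
          length vs                             ≤⟨ few-vs ⟩
          3                                     ∎) 1+n≰n
          where
          open ≤-Reasoning
          covers : ∀ {v} → v ∈ map (i ,_) (allFin (suc m)) → v ∈ vs
          covers v∈ with ∈-map⁻ (i ,_) v∈
          ... | j , _ , refl = decidable-stable (Any.any? ((i , j) ≟V_) vs) (λ ∉vs → none (j , ∉vs))

      all-shallow : (∀ i → Near (x i)) → ⊥
      all-shallow near = unrefutable pendant forbid shallowPaths 20 []
        ((0<4 , 1<4 , path λ ()) ∷ (0<4 , 2<4 , path λ ()) ∷ (1<4 , 2<4 , path λ ()) ∷
         (0<4 , 3<4 , path λ ()) ∷ (1<4 , 3<4 , path λ ()) ∷ (2<4 , 3<4 , path λ ()) ∷ [])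
        []
        (four-injective (distinct λ ()) (distinct λ ()) (distinct λ ()) (distinct λ ()) (distinct λ ()) (distinct λ ()))
        (λ {i} _ → four-all {P = Near} (inner-parent (near 0F)) (inner-parent (near 1F))
           (inner-parent (near 2F)) (inner-parent (near 3F)) i)
        refuted-shallow
        where
        base : ℕ → V
        base = four (c 0F) (c 1F) (c 2F) (c 3F)

        open Soundness (saturation id id) 4 z<s base shallowPendants shallowForbidden

        distinct : ∀ {i j} → i ≢ j → c i ≢ c j
        distinct {i} {j} i≢j = proj₁ (two-pendants (¬x i) (near i) (¬x j) (near j) (x-adj-x i≢j))

        path : ∀ {i j} → i ≢ j → SPath 1 (c i) (c j) (c i ∷ [])
        path {i} {j} i≢j = proj₂ (two-pendants (¬x i) (near i) (¬x j) (near j) (x-adj-x i≢j))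

        pendant-at : ∀ i {w} → Near w → w ≢ c i → All (λ k → toℕ (proj₁ w) ≢ k) (toℕ i ∷ []) → SPath 2 (c i) w (c i ∷ [])
        pendant-at i {w} near-w w≢ (p ∷ []) = pendant₂ (¬x i) near-w (x-adj w (p ∘ cong toℕ)) w≢

        pendant : ∀ {k l is} → (k , l , is) ∈ shallowPendants →
          k < 4 × (∀ {w} → Near w → w ≢ base k → All (λ i → toℕ (proj₁ w) ≢ i) is → SPath l (base k) w (base k ∷ []))
        pendant (here refl)                         = 0<4 , pendant-at 0F
        pendant (there (here refl))                 = 1<4 , pendant-at 1F
        pendant (there (there (here refl)))         = 2<4 , pendant-at 2F
        pendant (there (there (there (here refl)))) = 3<4 , pendant-at 3F

        forbid : ∀ {k i} → (k , i) ∈ shallowForbidden → k < 4 × toℕ (proj₁ (base k)) ≢ i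
        forbid (here refl)                         = 0<4 , part-c 0F ∘ Fin.toℕ-injective
        forbid (there (here refl))                 = 1<4 , part-c 1F ∘ Fin.toℕ-injective
        forbid (there (there (here refl)))         = 2<4 , part-c 2F ∘ Fin.toℕ-injective
        forbid (there (there (there (here refl)))) = 3<4 , part-c 3F ∘ Fin.toℕ-injective

      one-deep : ∀ d → ¬ Near (x d) → ⊥
      one-deep d ¬near with ranking (part-c d ∘ sym)
      ... | f , f-injective , rank-a , (b , rank-b) , (e , rank-e) , rank-d =
        unrefutable pendant forbid deepPaths 20 deepColours
          ((0<4 , 1<4 , adj d≢b b≢a) ∷ (0<4 , 2<4 , adj d≢e e≢a) ∷
           (1<4 , 2<4 , proj₂ be) ∷ (0<4 , 3<4 , deep-path d-y (y∉ ∘ here)) ∷ [])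
          ((0<4 , trans (cong (toℕ ∘ f) (trans part-c₀ (part-x d))) (cong toℕ rank-d)) ∷
           (3<4 , trans (cong (toℕ ∘ f) part-y) (cong toℕ rank-a)) ∷ [])
          (four-injective (~⇒≢ (adj d≢b b≢a)) (~⇒≢ (adj d≢e e≢a)) (λ c₀≡y → d-y (trans (sym part-c₀) (cong proj₁ c₀≡y)))
            (proj₁ be) (y∉ ∘ there ∘ here ∘ sym) (y∉ ∘ there ∘ there ∘ here ∘ sym))
          (λ {i} _ → four-all {P = Near} (inner-parent (shallow (x d))) (inner-parent (near-x d≢b)) (inner-parent (near-x d≢e)) near-y i)
          refuted-deep
        where
        open Deep {x d} ¬near hiding (¬x)

        a : Fin 4
        a = proj₁ u

        separate : ∀ {i j k l} → f i ≡ k → f j ≡ l → k ≢ l → i ≢ j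
        separate fi fj k≢l refl = k≢l (trans (sym fi) fj)

        d≢b : d ≢ b
        d≢b = separate rank-d rank-b λ ()
        d≢e : d ≢ e
        d≢e = separate rank-d rank-e λ ()
        d≢a : d ≢ a
        d≢a = separate rank-d rank-a λ ()
        b≢a : b ≢ a
        b≢a = separate rank-b rank-a λ ()
        e≢a : e ≢ a
        e≢a = separate rank-e rank-a λ ()
        b≢e : b ≢ e
        b≢e = separate rank-b rank-e λ ()

        near-x : ∀ {i} → d ≢ i → Near (x i)
        near-x {i} d≢i = near (¬x i) (x-adj-x d≢i)

        adj : ∀ {i} → d ≢ i → i ≢ a → c₀ ~ c i
        adj {i} d≢i i≢a = adjacent-to (¬x i) (x-adj-x d≢i) (λ xi≡u → i≢a (trans (sym (part-x i)) (cong proj₁ xi≡u)))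

        be : c b ≢ c e × SPath 1 (c b) (c e) (c b ∷ [])
        be = two-pendants (¬x b) (near-x d≢b) (¬x e) (near-x d≢e) (x-adj-x b≢e)

        -- Avoiding `u` makes `deep-path` applicable to `y`; avoiding `c b` and `c e` keeps the four
        -- base vertices distinct. The remaining one, `c₀`, lies in part `d`, not in part `a`.
        chosen = fresh a (u ∷ c b ∷ c e ∷ []) ≤-refl
        y = proj₁ chosen
        part-y = proj₁ (proj₂ chosen)
        y∉ = proj₂ (proj₂ chosen)

        d-y : KAdj (x d) y
        d-y = x-adj y (λ e → d≢a (trans (sym e) part-y))

        near-y : Near y
        near-y with inner? y
        ... | yes inner = inner-parent inner
        ... | no ¬inner = near ¬inner d-y

        base : ℕ → V
        base = four c₀ (c b) (c e) y

        colour : V → ℕ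
        colour v = toℕ (f (proj₁ v))

        open Soundness (saturation f f-injective) 4 z<s base deepPendants deepForbidden

        avoids : ∀ w {i} {k : Fin 4} → f i ≡ k → colour w ≢ toℕ k → proj₁ w ≢ i
        avoids w fi w≢ refl = w≢ (cong toℕ fi)

        pendant : ∀ {k l is} → (k , l , is) ∈ deepPendants →
          k < 4 × (∀ {w} → Near w → w ≢ base k → All (λ i → colour w ≢ i) is → SPath l (base k) w (base k ∷ []))
        pendant (here refl) = 0<4 , λ { {w} near-w w≢ (p ∷ []) → pendant₂ ¬near near-w (avoids w rank-a p ∘ sym) w≢ }
        pendant (there (here refl)) = 1<4 , λ { {w} near-w w≢ (p ∷ []) → pendant₂ (¬x b) near-w (x-adj w (avoids w rank-b p)) w≢ }
        pendant (there (there (here refl))) = 2<4 , λ { {w} near-w w≢ (p ∷ []) → pendant₂ (¬x e) near-w (x-adj w (avoids w rank-e p)) w≢ }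
        -- Excluding colour 3 puts `w` outside the part of `x d`; excluding colour 0, the colour of
        -- `u`, ensures `w ≢ u`. The base vertex `y` supplies one path to colour 0 that this pendant
        -- leaves out.
        pendant (there (there (there (here refl)))) =
          0<4 , λ { {w} near-w w≢ (p ∷ q ∷ []) → deep-path (x-adj w (avoids w rank-d q)) (λ w≡u → avoids w rank-a p (cong proj₁ w≡u)) }

        forbid : ∀ {k i} → (k , i) ∈ deepForbidden → k < 4 × colour (base k) ≢ i
        forbid (here refl)         = 1<4 , λ p → part-c b (f-injective (trans (Fin.toℕ-injective p) (sym rank-b)))
        forbid (there (here refl)) = 2<4 , λ p → part-c e (f-injective (trans (Fin.toℕ-injective p) (sym rank-e)))

      impossible : ⊥
      impossible with Fin.all? (λ i → inner? (parent (x i)))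
      ... | yes near = all-shallow near
      ... | no ¬near with Fin.¬∀⟶∃¬ 4 (λ i → Near (x i)) (λ i → inner? (parent (x i))) ¬near
      ... | d , ¬near-d = one-deep d ¬near-d

lower-bound : ∀ n → 10 ≤ n → (H : Graph n) → IsC5SaturatedRelK4 H → 4 * n + 2 ≤ edgeCount H
lower-bound (suc m) 10≤n H saturated with 4 * suc m + 2 ≤? edgeCount H
... | yes enough = enough
... | no ¬enough = ⊥-elim (Sparse.Kernel.Conclusion.impossible H saturated few tree
        (proj₁ extras) (proj₁ (proj₂ extras)) (proj₂ (proj₂ extras)) 10≤n)
  where
  few : edgeCount H ≤ 4 * suc m + 1
  few = s≤s⁻¹ (subst (edgeCount H <_) (+-suc (4 * suc m) 1) (≰⇒> ¬enough))
  tree = Saturated.bfs-tree H saturated (zero , zero)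
  extras = Sparse.extras H saturated few tree

-- The extremal graph

module _ {n : ℕ} (G : Graph n) where

  addEdge-old : ∀ s t {x y} → G x y ≡ true → addEdge G s t x y ≡ true
  addEdge-old s t e rewrite e = refl

  addEdge-new : ∀ s t → addEdge G s t s t ≡ true
  addEdge-new s t with G s t | s ≟V s | t ≟V t
  ... | true  | _     | _     = refl
  ... | false | yes _ | yes _ = refl
  ... | false | no ≢  | _     = contradiction refl ≢
  ... | false | yes _ | no ≢  = contradiction refl ≢

  addEdge-comm : ∀ s t x y → addEdge G s t x y ≡ addEdge G t s x y
  addEdge-comm s t x y = cong (G x y ∨_) (∨-comm (⌊ x ≟V s ⌋ ∧ ⌊ y ≟V t ⌋) _)

  -- Both orders of the added edge are served at once, since pairs consisting of a leaf and a vertex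
  -- of the K₄ occur in either order.
  close-path : ∀ {u a b c v} → u ≢ v → u ≢ a → u ≢ b → u ≢ c → a ≢ b → a ≢ c → a ≢ v → b ≢ c → b ≢ v → c ≢ v →
               G u a ≡ true → G a b ≡ true → G b c ≡ true → G c v ≡ true →
               ContainsC5 (addEdge G u v) × ContainsC5 (addEdge G v u)
  close-path {u} {a} {b} {c} {v} u≢v u≢a u≢b u≢c a≢b a≢c a≢v b≢c b≢v c≢v ua ab bc cv =
    (u , a , b , c , v , distinct , addEdge-old u v ua , addEdge-old u v ab , addEdge-old u v bc , addEdge-old u v cv ,
      trans (addEdge-comm u v v u) (addEdge-new v u)) ,
    (u , a , b , c , v , distinct , addEdge-old v u ua , addEdge-old v u ab , addEdge-old v u bc , addEdge-old v u cv ,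
      addEdge-new v u)
    where
    distinct = u≢a , u≢b , u≢c , u≢v , a≢b , a≢c , a≢v , b≢c , b≢v , c≢v

-- What matters is a permutation without fixed points: a leaf must hang in another part, and leaves
-- of different parts need different hubs, so that leaf, hub, third K₄ vertex, hub, leaf is a path.
hub : Fin 4 → Fin 4
hub 0F = 1F
hub 1F = 0F
hub 2F = 3F
hub 3F = 2F

hub≢ : ∀ p → hub p ≢ p
hub≢ = from-yes (Fin.all? λ p → ¬? (hub p Fin.≟ p))

hub-injective : ∀ p q → hub p ≡ hub q → p ≡ q
hub-injective = from-yes (Fin.all? λ p → Fin.all? λ q → (hub p Fin.≟ hub q) →-dec (p Fin.≟ q))

two-others? : Dec (∀ (i j : Fin 4) → i ≢ j → ∃[ k ] ∃[ l ] (k ≢ i × k ≢ j × l ≢ i × l ≢ j × k ≢ l))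
two-others? = Fin.all? λ i → Fin.all? λ j → ¬? (i Fin.≟ j) →-dec Fin.any? λ k → Fin.any? λ l →
  ¬? (k Fin.≟ i) ×-dec ¬? (k Fin.≟ j) ×-dec ¬? (l Fin.≟ i) ×-dec ¬? (l Fin.≟ j) ×-dec ¬? (k Fin.≟ l)

two-others : ∀ (i j : Fin 4) → i ≢ j → ∃[ k ] ∃[ l ] (k ≢ i × k ≢ j × l ≢ i × l ≢ j × k ≢ l)
two-others = from-yes two-others?

-- The vertices (i , 0) span a K₄, and every other vertex of part p is a leaf attached to (hub p , 0).
extremal : ∀ {m} → Graph (suc m)
extremal (i , zero)  (j , zero)  = not ⌊ i Fin.≟ j ⌋
extremal (i , zero)  (q , suc _) = ⌊ i Fin.≟ hub q ⌋
extremal (p , suc _) (j , zero)  = ⌊ j Fin.≟ hub p ⌋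
extremal (p , suc _) (q , suc _) = false

module _ {m : ℕ} where

  private
    V : Set
    V = Vertex (suc m)

    infix 4 _~_
    _~_ : V → V → Set
    u ~ v = extremal u v ≡ true

  extremal-sym : ∀ (u v : V) → extremal u v ≡ extremal v u
  extremal-sym (i , zero)  (j , zero)  with i Fin.≟ j | j Fin.≟ i
  ... | yes _   | yes _   = refl
  ... | yes i≡j | no j≢i  = contradiction (sym i≡j) j≢i
  ... | no i≢j  | yes j≡i = contradiction (sym j≡i) i≢j
  ... | no _    | no _    = refl
  extremal-sym (i , zero)  (q , suc _) = refl
  extremal-sym (p , suc _) (j , zero)  = refl
  extremal-sym (p , suc _) (q , suc _) = refl

  extremal-proper : ∀ (u v : V) → u ~ v → KAdj u v
  extremal-proper (i , zero)  (j , zero)  e i≡j with i Fin.≟ j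
  extremal-proper (i , zero)  (j , zero)  () i≡j | yes _
  ... | no i≢j = i≢j i≡j
  extremal-proper (i , zero)  (q , suc _) e i≡q with i Fin.≟ hub q
  ... | yes i≡ = hub≢ q (trans (sym i≡) i≡q)
  extremal-proper (p , suc _) (j , zero)  e p≡j with j Fin.≟ hub p
  ... | yes j≡ = hub≢ p (trans (sym j≡) (sym p≡j))

  leaf-neighbour : ∀ {p} {j : Fin m} {v : V} → (p , suc j) ~ v → v ≡ (hub p , zero)
  leaf-neighbour {p} {v = i , zero} e with i Fin.≟ hub p
  ... | yes refl = refl

  leaf-neighbour-unique : ∀ {p} {j : Fin m} {u v : V} → u ~ (p , suc j) → (p , suc j) ~ v → u ≡ v
  leaf-neighbour-unique {u = u} e e′ = trans (leaf-neighbour (trans (extremal-sym _ u) e)) (sym (leaf-neighbour e′))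

  -- A leaf cannot have two distinct neighbours on a cycle, and without leaves only four vertices
  -- remain.
  extremal-C5-free : ¬ ContainsC5 (extremal {m})
  extremal-C5-free ((_ , suc _) , b , c , d , e , (_ , _ , _ , _ , _ , _ , b≢e , _) , (ab , bc , cd , de , ea)) =
    b≢e (sym (leaf-neighbour-unique ea ab))
  extremal-C5-free (a , (_ , suc _) , c , d , e , (_ , a≢c , _) , (ab , bc , cd , de , ea)) =
    a≢c (leaf-neighbour-unique ab bc)
  extremal-C5-free (a , b , (_ , suc _) , d , e , (_ , _ , _ , _ , _ , b≢d , _) , (ab , bc , cd , de , ea)) =
    b≢d (leaf-neighbour-unique bc cd)
  extremal-C5-free (a , b , c , (_ , suc _) , e , (_ , _ , _ , _ , _ , _ , _ , _ , c≢e , _) , (ab , bc , cd , de , ea)) =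
    c≢e (leaf-neighbour-unique cd de)
  extremal-C5-free (a , b , c , d , (_ , suc _) , (_ , _ , a≢d , _) , (ab , bc , cd , de , ea)) =
    a≢d (sym (leaf-neighbour-unique de ea))
  extremal-C5-free ((a , zero) , (b , zero) , (c , zero) , (d , zero) , (e , zero) ,
    (a≢b , a≢c , a≢d , a≢e , b≢c , b≢d , b≢e , c≢d , c≢e , d≢e) , _) = pigeons (Fin.pigeonhole ≤-refl (lookup (a ∷ b ∷ c ∷ d ∷ e ∷ [])))
    where
    pigeons : ¬ (∃[ i ] ∃[ j ] (i Fin.< j × lookup (a ∷ b ∷ c ∷ d ∷ e ∷ []) i ≡ lookup (a ∷ b ∷ c ∷ d ∷ e ∷ []) j))
    pigeons (0F , 1F , _ , refl) = a≢b refl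
    pigeons (0F , 2F , _ , refl) = a≢c refl
    pigeons (0F , 3F , _ , refl) = a≢d refl
    pigeons (0F , 4F , _ , refl) = a≢e refl
    pigeons (1F , 2F , _ , refl) = b≢c refl
    pigeons (1F , 3F , _ , refl) = b≢d refl
    pigeons (1F , 4F , _ , refl) = b≢e refl
    pigeons (2F , 3F , _ , refl) = c≢d refl
    pigeons (2F , 4F , _ , refl) = c≢e refl
    pigeons (3F , 4F , _ , refl) = d≢e refl
    pigeons (1F , 1F , s≤s () , _)
    pigeons (2F , 1F , s≤s () , _)
    pigeons (2F , 2F , s≤s (s≤s ()) , _)
    pigeons (3F , 1F , s≤s () , _)
    pigeons (3F , 2F , s≤s (s≤s ()) , _)
    pigeons (3F , 3F , s≤s (s≤s (s≤s ())) , _)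
    pigeons (4F , 1F , s≤s () , _)
    pigeons (4F , 2F , s≤s (s≤s ()) , _)
    pigeons (4F , 3F , s≤s (s≤s (s≤s ())) , _)
    pigeons (4F , 4F , s≤s (s≤s (s≤s (s≤s ()))) , _)

  hub-hub : ∀ {i j} → i ≢ j → _~_ (i , zero) (j , zero)
  hub-hub {i} {j} i≢j with i Fin.≟ j
  ... | yes i≡j = contradiction i≡j i≢j
  ... | no _    = refl

  leaf-hub : ∀ {p} {j : Fin m} → _~_ (p , suc j) (hub p , zero)
  leaf-hub {p} with hub p Fin.≟ hub p
  ... | yes _  = refl
  ... | no ≢   = contradiction refl ≢

  part≢ : {u v : V} → KAdj u v → u ≢ v
  part≢ k refl = k refl

  leaf≢hub : ∀ {i p} {j : Fin m} → _≢_ {A = V} (p , suc j) (i , zero)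
  leaf≢hub ()

  -- From the leaf the path visits its hub and then the other three vertices of the K₄, ending in
  -- `(i , zero)`.
  leaf-hub-saturated : ∀ {p i} {j : Fin m} → extremal {m} (p , suc j) (i , zero) ≡ false →
                       ContainsC5 (addEdge extremal (p , suc j) (i , zero)) × ContainsC5 (addEdge extremal (i , zero) (p , suc j))
  leaf-hub-saturated {p} {i} {j} e with i Fin.≟ hub p
  ... | no i≢ with two-others (hub p) i (i≢ ∘ sym)
  ... | k , l , k≢p , k≢i , l≢p , l≢i , k≢l =
    close-path extremal {_ , suc j} {hub p , zero} {k , zero} {l , zero} {i , zero} leaf≢hub leaf≢hub leaf≢hub leaf≢hub
      (part≢ (k≢p ∘ sym)) (part≢ (l≢p ∘ sym)) (part≢ (i≢ ∘ sym)) (part≢ k≢l) (part≢ k≢i) (part≢ l≢i)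
      (leaf-hub {p} {j}) (hub-hub (k≢p ∘ sym)) (hub-hub k≢l) (hub-hub l≢i)

  extremal-saturated : ∀ (u v : V) → KAdj u v → extremal u v ≡ false → ContainsC5 (addEdge extremal u v)
  extremal-saturated (i , zero)  (j , zero)  i≢j e = contradiction (trans (sym (hub-hub i≢j)) e) λ ()
  extremal-saturated (i , zero)  (q , suc k) i≢q e = proj₂ (leaf-hub-saturated {q} {i} {k} e)
  extremal-saturated (p , suc j) (i , zero)  p≢i e = proj₁ (leaf-hub-saturated {p} {i} {j} e)
  extremal-saturated (p , suc j) (q , suc k) p≢q e with two-others (hub p) (hub q) (p≢q ∘ hub-injective p q)
  ... | l , _ , l≢p , l≢q , _ = proj₁ (close-path extremal {_ , suc j} {hub p , zero} {l , zero} {hub q , zero} {_ , suc k}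
    (part≢ p≢q) leaf≢hub leaf≢hub leaf≢hub (part≢ (l≢p ∘ sym)) (part≢ (p≢q ∘ hub-injective p q)) (leaf≢hub ∘ sym)
    (part≢ l≢q) (leaf≢hub ∘ sym) (leaf≢hub ∘ sym)
    (leaf-hub {p} {j}) (hub-hub (l≢p ∘ sym)) (hub-hub l≢q) (trans (extremal-sym (hub q , zero) (q , suc k)) (leaf-hub {q} {k})))

  sum-part : ∀ (g : Fin (suc m) → ℕ) c → (∀ j → g (suc j) ≡ c) → sum (map g (allFin (suc m))) ≡ g zero + m * c
  sum-part g c g≡c = cong (g zero +_) (begin
    sum (map g (tabulate suc))            ≡⟨ cong sum (trans (map-tabulate suc g) (sym (map-tabulate id (g ∘ suc)))) ⟩
    sum (map (g ∘ suc) (allFin m))        ≡⟨ cong sum (map-cong g≡c (allFin m)) ⟩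
    sum (map (λ _ → c) (allFin m))        ≡⟨ sum-const c (allFin m) ⟩
    length (allFin m) * c                 ≡⟨ cong (_* c) (length-tabulate {n = m} id) ⟩
    m * c                                 ∎)
    where open ≡-Reasoning

  sum-vertices : ∀ (g : V → ℕ) (c : Fin 4 → ℕ) → (∀ i j → g (i , suc j) ≡ c i) →
                 sum (map g (vertices (suc m))) ≡ sum (map (λ i → g (i , zero) + m * c i) (allFin 4))
  sum-vertices g c g≡c = trans (sum-cartesianProduct g (allFin 4) (allFin (suc m)))
    (cong sum (map-cong (λ i → sum-part (λ j → g (i , j)) (c i) (g≡c i)) (allFin 4)))

  weight : Bool → ℕ
  weight b = if b then 1 else 0

  degree : V → ℕ
  degree u = sum (map (λ v → weight (extremal u v)) (vertices (suc m)))

  degree-hub : ∀ i → degree (i , zero) ≡ 3 + m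
  degree-hub i = trans (sum-vertices _ (λ q → weight ⌊ i Fin.≟ hub q ⌋) (λ _ _ → refl)) (go i)
    where
    open +-*-Solver
    go : ∀ i → sum (map (λ q → weight (not ⌊ i Fin.≟ q ⌋) + m * weight ⌊ i Fin.≟ hub q ⌋) (allFin 4)) ≡ 3 + m
    go 0F = solve 1 (λ m → m :* con 0 :+ (con 1 :+ m :* con 1 :+ (con 1 :+ m :* con 0 :+ (con 1 :+ m :* con 0 :+ con 0)))
               := con 3 :+ m) refl m
    go 1F = solve 1 (λ m → con 1 :+ m :* con 1 :+ (m :* con 0 :+ (con 1 :+ m :* con 0 :+ (con 1 :+ m :* con 0 :+ con 0)))
               := con 3 :+ m) refl m
    go 2F = solve 1 (λ m → con 1 :+ m :* con 0 :+ (con 1 :+ m :* con 0 :+ (m :* con 0 :+ (con 1 :+ m :* con 1 :+ con 0)))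
               := con 3 :+ m) refl m
    go 3F = solve 1 (λ m → con 1 :+ m :* con 0 :+ (con 1 :+ m :* con 0 :+ (con 1 :+ m :* con 1 :+ (m :* con 0 :+ con 0)))
               := con 3 :+ m) refl m

  degree-leaf : ∀ p j → degree (p , suc j) ≡ 1
  degree-leaf p j = trans (sum-vertices _ (λ _ → 0) (λ _ _ → refl))
    (trans (cong sum (map-cong (λ i → trans (cong (weight ⌊ i Fin.≟ hub p ⌋ +_) (*-zeroʳ m)) (+-identityʳ _)) (allFin 4))) (go p))
    where
    go : ∀ p → sum (map (λ i → weight ⌊ i Fin.≟ hub p ⌋) (allFin 4)) ≡ 1
    go = from-yes (Fin.all? λ p → sum (map (λ i → weight ⌊ i Fin.≟ hub p ⌋) (allFin 4)) ≟ 1)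

  edgeCount-extremal : edgeCount (extremal {m}) ≡ 4 * suc m + 2
  edgeCount-extremal = trans (cong ⌊_/2⌋ (begin
    sum (map degree (vertices (suc m)))                                        ≡⟨ sum-vertices degree (λ _ → 1) degree-leaf ⟩
    sum (map (λ i → degree (i , zero) + m * 1) (allFin 4))                     ≡⟨ cong sum (map-cong (λ i → cong (_+ m * 1) (degree-hub i)) (allFin 4)) ⟩
    sum (map (λ _ → 3 + m + m * 1) (allFin 4))                                 ≡⟨ solve 1 (λ m → let d = con 3 :+ m :+ m :* con 1 in
                                                                                    d :+ (d :+ (d :+ (d :+ con 0))) := (con 4 :* (con 1 :+ m) :+ con 2) :+ (con 4 :* (con 1 :+ m) :+ con 2)) refl m ⟩
    (4 * suc m + 2) + (4 * suc m + 2)                                          ∎)) (sym (n≡⌊n+n/2⌋ (4 * suc m + 2)))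
    where
    open ≡-Reasoning
    open +-*-Solver

theorem1p7 : ∀ (n : ℕ) → n ≥ 10 → SatK4C5≡ n (4 * n + 2)
theorem1p7 (suc m) n≥10 =
  (extremal , ((extremal-sym , extremal-proper) , extremal-C5-free , extremal-saturated) , edgeCount-extremal) ,
  lower-bound (suc m) n≥10
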